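{- Let $C$ be a linear $[n,k,d]_q$ NMDS code with $d=n-k$, and for $m\ge1$ let $C_m$ be its $m$-lifted code over $\mathbb{F}_{q^m}$ (an $[n,k,n-k]_{q^m}$ NMDS code, $C_1=C$). Then for all $m\ge1$ and $s\ge1$, $$A_{d+s}(C_m)=\binom{n}{k-s}\sum_{j=0}^{s-1}(-1)^j\binom{d+s}{j}\left(q^{m(s-j)}-1\right)+(-1)^s\binom{k}{s}\frac{A_d(C)}{q-1}(q^m-1).$$ Moreover, if $A_d(C)=\binom{n}{k-1}\frac{q-1}{k}$ (which implies $A_{d+1}(C)=0$), then for all $m\ge1$, $$A_d(C_m)=\binom{n}{k-1}\frac{q^m-1}{k},\qquad A_{d+1}(C_m)=0.$$
   Context: An $[n,k,d]_q$ code is a $k$-dimensional linear subspace of $\mathbb{F}_q^n$ with minimum Hamming distance $d$; $A_i(C)$ is its number of codewords of Hamming weight $i$; $\binom{a}{b}=0$ for $b<0$. A linear $[n,k,n-k]_q$ code $C$ is near-MDS (NMDS) if its dual $C^\perp$ is an $[n,n-k,k]_q$ code. For a linear code $C$ over $\mathbb{F}_q$ with parity check matrix $H$, the $m$-lifted code $C_m$ ($m\ge1$) is $\{x\in\mathbb{F}_{q^m}^n:Hx^T=0\}$, i.e. the code over $\mathbb{F}_{q^m}$ with the same parity check matrix (equivalently the $\mathbb{F}_{q^m}$-span of $C$). -}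

module Defs where

open import Level using (0ℓ)
open import Data.Nat as ℕ using (ℕ; zero; suc; _≤_; _≤?_)
import Data.Nat.Combinatorics as Comb
open import Data.Integer as ℤ using (ℤ; +_)
open import Data.Fin using (Fin; zero; suc)
open import Data.Vec using (Vec; []; _∷_; map; zipWith; replicate; foldr′)
open import Data.List using (List; length)
open import Data.List.Relation.Unary.All using (All)
open import Data.List.Relation.Unary.Unique.Propositional using (Unique)
open import Data.List.Membership.Propositional using (_∈_)
open import Data.Product using (Σ; ∃; _×_)
open import Relation.Nullary using (¬_; yes; no)
open import Relation.Binary.Definitions using (DecidableEquality)
open import Relation.Binary.PropositionalEquality using (_≡_; _≢_)
open import Algebra.Structures using (IsCommutativeRing)

record FiniteField : Set₁ where
  infixl 6 _+_
  infixl 7 _*_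
  field
    Carrier  : Set
    _+_ _*_  : Carrier → Carrier → Carrier
    -_       : Carrier → Carrier
    0# 1#    : Carrier
    isCommutativeRing : IsCommutativeRing _≡_ _+_ _*_ -_ 0# 1#
    0≢1      : 0# ≢ 1#
    inverse  : ∀ x → x ≢ 0# → Σ Carrier (λ y → x * y ≡ 1#)
    _≟_      : DecidableEquality Carrier
    elements : List Carrier
    unique   : Unique elements
    complete : ∀ x → x ∈ elements

  size : ℕ
  size = length elements

open FiniteField public using () renaming (Carrier to ⟨_⟩; size to size)

Count : {A : Set} → (A → Set) → ℕ → Set
Count {A} P N = Σ (List A) λ xs →
  Unique xs × All P xs × (∀ x → P x → x ∈ xs) × length xs ≡ N

module _ (F : FiniteField) where
  open FiniteField F

  Vect : ℕ → Set
  Vect n = Vec Carrier n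

  0v : ∀ {n} → Vect n
  0v = replicate _ 0#

  _⊕_ : ∀ {n} → Vect n → Vect n → Vect n
  _⊕_ = zipWith _+_

  _⊙_ : ∀ {n} → Carrier → Vect n → Vect n
  a ⊙ v = map (a *_) v

  wt : ∀ {n} → Vect n → ℕ
  wt []      = 0
  wt (x ∷ v) with x ≟ 0#
  ... | yes _ = wt v
  ... | no  _ = suc (wt v)

  dot : ∀ {n} → Vect n → Vect n → Carrier
  dot x y = foldr′ _+_ 0# (zipWith _*_ x y)

  lincomb : ∀ {n} r → (Fin r → Carrier) → (Fin r → Vect n) → Vect n
  lincomb zero    c v = 0v
  lincomb (suc r) c v = (c zero ⊙ v zero) ⊕ lincomb r (λ j → c (suc j)) (λ j → v (suc j))

  Code : ℕ → Set₁
  Code n = Vect n → Set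

  IsLinear : ∀ {n} → Code n → Set
  IsLinear 𝒞 = 𝒞 0v × (∀ x y → 𝒞 x → 𝒞 y → 𝒞 (x ⊕ y)) × (∀ a x → 𝒞 x → 𝒞 (a ⊙ x))

  HasDim : ∀ {n} → Code n → ℕ → Set
  HasDim {n} 𝒞 k = Σ (Fin k → Vect n) λ b →
      (∀ i → 𝒞 (b i))
    × (∀ c → lincomb k c b ≡ 0v → ∀ i → c i ≡ 0#)
    × (∀ x → 𝒞 x → Σ (Fin k → Carrier) λ c → x ≡ lincomb k c b)

  HasMinDist : ∀ {n} → Code n → ℕ → Set
  HasMinDist 𝒞 d =
      (Σ _ λ x → 𝒞 x × x ≢ 0v × wt x ≡ d)
    × (∀ x → 𝒞 x → x ≢ 0v → d ≤ wt x)

  Dual : ∀ {n} → Code n → Code n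
  Dual 𝒞 y = ∀ x → 𝒞 x → dot x y ≡ 0#

  IsNMDS : ∀ n k → Code n → Set
  IsNMDS n k 𝒞 =
      IsLinear 𝒞 × HasDim 𝒞 k × HasMinDist 𝒞 (n ℕ.∸ k)
    × HasDim (Dual 𝒞) (n ℕ.∸ k) × HasMinDist (Dual 𝒞) k

  WeightCount : ∀ {n} → Code n → ℕ → ℕ → Set
  WeightCount 𝒞 i N = Count (λ x → 𝒞 x × wt x ≡ i) N

record Extension (K : FiniteField) (m : ℕ) : Set₁ where
  field
    L   : FiniteField
    ι   : ⟨ K ⟩ → ⟨ L ⟩
    ι-+ : ∀ a b → ι (FiniteField._+_ K a b) ≡ FiniteField._+_ L (ι a) (ι b)
    ι-* : ∀ a b → ι (FiniteField._*_ K a b) ≡ FiniteField._*_ L (ι a) (ι b)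
    ι-1 : ι (FiniteField.1# K) ≡ FiniteField.1# L
    size-L : size L ≡ size K ℕ.^ m

Lifted : ∀ {K m n} (E : Extension K m) → Code K n → Code (Extension.L E) n
Lifted {K} {m} {n} E 𝒞 x =
  Σ ℕ λ r → Σ (Fin r → ⟨ L ⟩) λ c → Σ (Fin r → Vect K n) λ v →
    (∀ j → 𝒞 (v j)) × x ≡ lincomb L r c (λ j → map ι (v j))
  where open Extension E

choose- : ℕ → ℕ → ℕ → ℕ
choose- n k s with s ≤? k
... | yes _ = Comb._C_ n (k ℕ.∸ s)
... | no  _ = 0

sgn : ℕ → ℤ
sgn zero    = + 1
sgn (suc j) = ℤ.- sgn j

sumTo : ℕ → (ℕ → ℤ) → ℤ
sumTo zero    f = + 0
sumTo (suc s) f = sumTo s f ℤ.+ f s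

module Submission where

-- Fix a set T of t positions. For t < k the dual distance makes C surject onto the coordinates in T, so q^{m(k-t)}
-- words of C_m vanish on T; for t = k either only 0 does, or a one-dimensional space of words, and which of the two
-- happens is already decided over F_q. Linear (in)dependence over F_q is certified by a biorthogonal family, which
-- any field extension preserves. Counting pairs (T, nonzero word of C_m vanishing on T) in two ways
-- gives the binomial moments, for t ≤ k, of the number of zeros of a nonzero word, a number that is at most k;
-- binomial inversion then yields the weight distribution, and the case t = k over F_q itself identifies the number of
-- exceptional T as A_d(C)/(q-1).

open import Defs
open import Level using (0ℓ)
open import Algebra.Bundles using (CommutativeRing)
import Algebra.Properties.Ring
import Algebra.Properties.Semiring.Sum
open import Data.Fin using (Fin; zero; suc)
import Data.Fin.Properties as Finₚ
open import Data.Integer using (ℤ; +_; _-_)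
import Data.Integer as Z
import Data.Integer.Properties as Zₚ
import Data.Integer.Tactic.RingSolver as ZS
open import Data.List using (List; []; _∷_; _++_; length; filter; map; cartesianProductWith; cartesianProduct)
open import Data.List.Properties using (length-map; length-++; filter-++; filter-accept; filter-reject; filter-none)
open import Data.List.Membership.Propositional using (_∈_)
open import Data.List.Membership.Propositional.Properties
  using (∈-map⁺; ∈-map⁻; ∈-filter⁺; ∈-filter⁻; ∈-cartesianProduct⁺; ∈-cartesianProduct⁻; ∈-cartesianProductWith⁺)
open import Data.List.Membership.Propositional.Properties.WithK using (unique∧set⇒bag)
open import Data.List.Relation.Binary.BagAndSetEquality using (∼bag⇒↭)
open import Data.List.Relation.Binary.Permutation.Propositional.Properties using (↭-length)
open import Data.List.Relation.Unary.All using (All; []; _∷_)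
import Data.List.Relation.Unary.All as All
open import Data.List.Relation.Unary.AllPairs using ([]; _∷_)
open import Data.List.Relation.Unary.Any using (here; there)
open import Data.List.Relation.Unary.Unique.Propositional using (Unique)
import Data.List.Relation.Unary.Unique.Propositional.Properties as Uniqueₚ
open import Data.Nat using (ℕ; zero; suc; _≤_; _<_; z≤n; s≤s; _∸_; _^_; _!; NonZero)
import Data.Nat as N
open import Data.Nat.Combinatorics
  using (_C_; nCk≡n!/k![n-k]!; k![n∸k]!∣n!; nCk≡nC[n∸k]; k>n⇒nCk≡0; nCn≡1; nC1≡n; nCk+nC[k+1]≡[n+1]C[k+1])
import Data.Nat.DivMod as DivMod
open import Data.Nat.ListAction using (sum)
import Data.Nat.Properties as Nₚ
import Data.Nat.Tactic.RingSolver as NS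
open import Data.Product using (Σ; ∃; _×_; _,_; proj₁; proj₂)
open import Data.Sum using (_⊎_; inj₁; inj₂; [_,_]′)
open import Data.Vec using (Vec; []; _∷_; lookup; tabulate)
import Data.Vec as Vec
import Data.Vec.Properties as Vecₚ
open import Function using (_∘_; id; mk⇔)
open import Relation.Binary.PropositionalEquality
open import Relation.Nullary using (Dec; yes; no; contradiction; ¬?)
open import Relation.Nullary.Decidable using (decidable-stable)
open import Relation.Unary using (Decidable)

open ≡-Reasoning

-- Binomial inversion

-- The shape of the formula comes from the inversion. Words of weight d+s have a = k-s zeros, and
-- they are counted by the sum over j ≤ s of (-1)^j C(a+j,a) M(a+j), with M(t) the t-th binomial
-- moment; the sum can stop at j = s because no nonzero word has more than k = a+s zeros. As n =
-- a+(d+s), trinomial revision turns C(a+j,a) C(n,a+j) into C(n,a) C(d+s,j), which gives the sum in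
-- the theorem. The last index j = s is the exceptional moment t = k and gives (-1)^s C(k,s) β
-- (q^m-1), where β is the number of exceptional k-sets. The obstacle is that both the bound on the
-- zeros and the one-dimensionality at t = k need minimum distance at least d for C_m, while only
-- that of C is given. It descends: the zero set of a nonzero word of C_m cannot determine the
-- message, so the basis restricted to it is already dependent over F_q, and the dependency is a
-- word of C with at least those zeros. Since β is an integer that does not depend on m,
-- A_d(C)/(q-1) never has to be formed. The extremal hypothesis says k β = C(n,k-1), and this
-- cancels the two terms at s = 1.

C-! : ∀ a b → ((a N.+ b) C a) N.* (a ! N.* b !) ≡ (a N.+ b) !
C-! a b = begin
  ((a N.+ b) C a) N.* (a ! N.* b !)
    ≡⟨ cong (N._* (a ! N.* b !)) (nCk≡n!/k![n-k]! (Nₚ.m≤m+n a b)) ⟩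
  (DivMod._/_ ((a N.+ b) !) (a ! N.* ((a N.+ b) ∸ a) !)) N.* (a ! N.* b !)
    ≡⟨ cong (λ c → DivMod._/_ ((a N.+ b) !) (a ! N.* ((a N.+ b) ∸ a) !) N.* (a ! N.* c !)) (sym (Nₚ.m+n∸m≡n a b)) ⟩
  (DivMod._/_ ((a N.+ b) !) (a ! N.* ((a N.+ b) ∸ a) !)) N.* (a ! N.* ((a N.+ b) ∸ a) !)
    ≡⟨ DivMod.m/n*n≡m (k![n∸k]!∣n! (Nₚ.m≤m+n a b)) ⟩
  (a N.+ b) ! ∎
  where
  instance
    _ : NonZero (a ! N.* ((a N.+ b) ∸ a) !)
    _ = Nₚ._!*_!≢0 a ((a N.+ b) ∸ a)

C-sym : ∀ a b → (a N.+ b) C a ≡ (a N.+ b) C b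
C-sym a b = trans (nCk≡nC[n∸k] (Nₚ.m≤m+n a b)) (cong ((a N.+ b) C_) (Nₚ.m+n∸m≡n a b))

-- Multiplied by a! j! r!, both sides become (a+j+r)!. The remainder `r` replaces a truncated
-- difference.
C-trinomial-+ : ∀ a j r →
  ((a N.+ j) C a) N.* ((a N.+ (j N.+ r)) C (a N.+ j)) ≡ ((a N.+ (j N.+ r)) C a) N.* ((j N.+ r) C j)
C-trinomial-+ a j r = Nₚ.*-cancelʳ-≡ _ _ (a ! N.* (j ! N.* r !)) (trans lhs (sym rhs))
  where
  instance
    _ : NonZero (a ! N.* (j ! N.* r !))
    _ = Nₚ.m*n≢0 (a !) (j ! N.* r !) {{Nₚ._!≢0 a}} {{Nₚ._!*_!≢0 j r}}
  lhs : ((a N.+ j) C a) N.* ((a N.+ (j N.+ r)) C (a N.+ j)) N.* (a ! N.* (j ! N.* r !)) ≡ (a N.+ (j N.+ r)) !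
  lhs = begin
    ((a N.+ j) C a) N.* ((a N.+ (j N.+ r)) C (a N.+ j)) N.* (a ! N.* (j ! N.* r !))
      ≡⟨ shuffle ((a N.+ j) C a) ((a N.+ (j N.+ r)) C (a N.+ j)) (a !) (j !) (r !) ⟩
    ((a N.+ (j N.+ r)) C (a N.+ j)) N.* (((a N.+ j) C a) N.* (a ! N.* j !) N.* r !)
      ≡⟨ cong₂ (λ u v → (u C (a N.+ j)) N.* (v N.* r !)) (sym (Nₚ.+-assoc a j r)) (C-! a j) ⟩
    (((a N.+ j) N.+ r) C (a N.+ j)) N.* ((a N.+ j) ! N.* r !)
      ≡⟨ C-! (a N.+ j) r ⟩
    ((a N.+ j) N.+ r) !
      ≡⟨ cong _! (Nₚ.+-assoc a j r) ⟩
    (a N.+ (j N.+ r)) ! ∎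
    where
    shuffle : ∀ u v x y z → u N.* v N.* (x N.* (y N.* z)) ≡ v N.* (u N.* (x N.* y) N.* z)
    shuffle = NS.solve-∀
  rhs : ((a N.+ (j N.+ r)) C a) N.* ((j N.+ r) C j) N.* (a ! N.* (j ! N.* r !)) ≡ (a N.+ (j N.+ r)) !
  rhs = begin
    ((a N.+ (j N.+ r)) C a) N.* ((j N.+ r) C j) N.* (a ! N.* (j ! N.* r !))
      ≡⟨ shuffle ((a N.+ (j N.+ r)) C a) ((j N.+ r) C j) (a !) (j ! N.* r !) ⟩
    ((a N.+ (j N.+ r)) C a) N.* (a ! N.* (((j N.+ r) C j) N.* (j ! N.* r !)))
      ≡⟨ cong (λ u → ((a N.+ (j N.+ r)) C a) N.* (a ! N.* u)) (C-! j r) ⟩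
    ((a N.+ (j N.+ r)) C a) N.* (a ! N.* (j N.+ r) !)
      ≡⟨ C-! a (j N.+ r) ⟩
    (a N.+ (j N.+ r)) ! ∎
    where
    shuffle : ∀ u v x y → u N.* v N.* (x N.* y) ≡ u N.* (x N.* (v N.* y))
    shuffle = NS.solve-∀

-- Serves twice: with a+p the number of zeros of a word, to evaluate the inversion on that word, and
-- with a+p = n, to simplify the moments. For j > p both sides are zero.
C-trinomial : ∀ a p j → ((a N.+ j) C a) N.* ((a N.+ p) C (a N.+ j)) ≡ ((a N.+ p) C a) N.* (p C j)
C-trinomial a p j with j N.≤? p
... | yes j≤p = subst
        (λ q → ((a N.+ j) C a) N.* ((a N.+ q) C (a N.+ j)) ≡ ((a N.+ q) C a) N.* (q C j))
        (Nₚ.m+[n∸m]≡n j≤p) (C-trinomial-+ a j (p ∸ j))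
... | no  j≰p = begin
  ((a N.+ j) C a) N.* ((a N.+ p) C (a N.+ j))
    ≡⟨ cong (((a N.+ j) C a) N.*_) (k>n⇒nCk≡0 (Nₚ.+-monoʳ-< a (Nₚ.≰⇒> j≰p))) ⟩
  ((a N.+ j) C a) N.* 0
    ≡⟨ Nₚ.*-zeroʳ ((a N.+ j) C a) ⟩
  0
    ≡⟨ sym (Nₚ.*-zeroʳ ((a N.+ p) C a)) ⟩
  ((a N.+ p) C a) N.* 0
    ≡⟨ cong (((a N.+ p) C a) N.*_) (sym (k>n⇒nCk≡0 (Nₚ.≰⇒> j≰p))) ⟩
  ((a N.+ p) C a) N.* (p C j) ∎

sumTo-cong : ∀ s {f g : ℕ → ℤ} → (∀ j → j < s → f j ≡ g j) → sumTo s f ≡ sumTo s g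
sumTo-cong zero    f≡g = refl
sumTo-cong (suc s) f≡g =
  cong₂ Z._+_ (sumTo-cong s (λ j j<s → f≡g j (Nₚ.m<n⇒m<1+n j<s))) (f≡g s (Nₚ.n<1+n s))

sumTo-zero : ∀ s → sumTo s (λ _ → + 0) ≡ + 0
sumTo-zero zero    = refl
sumTo-zero (suc s) = cong (Z._+ + 0) (sumTo-zero s)

sumTo-+ : ∀ s (f g : ℕ → ℤ) → sumTo s (λ j → f j Z.+ g j) ≡ sumTo s f Z.+ sumTo s g
sumTo-+ zero    f g = refl
sumTo-+ (suc s) f g = trans (cong (Z._+ (f s Z.+ g s)) (sumTo-+ s f g)) (shuffle (sumTo s f) (sumTo s g) (f s) (g s))
  where
  shuffle : ∀ a b c d → (a Z.+ b) Z.+ (c Z.+ d) ≡ (a Z.+ c) Z.+ (b Z.+ d)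
  shuffle = ZS.solve-∀

sumTo-*ˡ : ∀ s c (f : ℕ → ℤ) → c Z.* sumTo s f ≡ sumTo s (λ j → c Z.* f j)
sumTo-*ˡ zero    c f = Zₚ.*-zeroʳ c
sumTo-*ˡ (suc s) c f =
  trans (Zₚ.*-distribˡ-+ c (sumTo s f) (f s)) (cong (Z._+ c Z.* f s) (sumTo-*ˡ s c f))

-- Pascal's rule makes the partial sums telescope. The value is zero once p < s, that is, once the
-- sum covers the whole row.
sum-alternating-C-suc : ∀ p s → sumTo (suc s) (λ j → sgn j Z.* + (suc p C j)) ≡ sgn s Z.* + (p C s)
sum-alternating-C-suc p zero    = refl
sum-alternating-C-suc p (suc s) = begin
  sumTo (suc s) (λ j → sgn j Z.* + (suc p C j)) Z.+ sgn (suc s) Z.* + (suc p C suc s)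
    ≡⟨ cong₂ (λ u v → u Z.+ sgn (suc s) Z.* + v) (sum-alternating-C-suc p s) (sym (nCk+nC[k+1]≡[n+1]C[k+1] p s)) ⟩
  sgn s Z.* + (p C s) Z.+ Z.- sgn s Z.* (+ (p C s) Z.+ + (p C suc s))
    ≡⟨ cancel (sgn s) (+ (p C s)) (+ (p C suc s)) ⟩
  Z.- sgn s Z.* + (p C suc s) ∎
  where
  cancel : ∀ x u v → x Z.* u Z.+ Z.- x Z.* (u Z.+ v) ≡ Z.- x Z.* v
  cancel = ZS.solve-∀

sum-alternating-C-zero : ∀ s → sumTo (suc s) (λ j → sgn j Z.* + (0 C j)) ≡ + 1
sum-alternating-C-zero zero    = refl
sum-alternating-C-zero (suc s) = begin
  sumTo (suc s) (λ j → sgn j Z.* + (0 C j)) Z.+ sgn (suc s) Z.* + (0 C suc s)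
    ≡⟨ cong₂ (λ u v → u Z.+ sgn (suc s) Z.* + v) (sum-alternating-C-zero s) (k>n⇒nCk≡0 {0} {suc s} (s≤s z≤n)) ⟩
  + 1 Z.+ sgn (suc s) Z.* + 0
    ≡⟨ cong (λ u → + 1 Z.+ u) (Zₚ.*-zeroʳ (sgn (suc s))) ⟩
  + 1 ∎

-- Recovers the number of objects with statistic exactly `a` from the binomial moments `M`, by
-- inclusion-exclusion; the cut at `s` is legitimate when the statistic never exceeds a+s.
binomial-inversion : ℕ → ℕ → (ℕ → ℕ) → ℤ
binomial-inversion a s M = sumTo (suc s) (λ j → sgn j Z.* (+ ((a N.+ j) C a) Z.* + M (a N.+ j)))

private
  reassoc : ∀ x y w → x Z.* (y Z.* w) ≡ y Z.* (x Z.* w)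
  reassoc = ZS.solve-∀

-- Trinomial revision frees one binomial factor of j, leaving a partial alternating sum of row p.
inversion-C-+ : ∀ a s p →
  binomial-inversion a s ((a N.+ p) C_) ≡ + ((a N.+ p) C a) Z.* sumTo (suc s) (λ j → sgn j Z.* + (p C j))
inversion-C-+ a s p = begin
  sumTo (suc s) (λ j → sgn j Z.* (+ ((a N.+ j) C a) Z.* + ((a N.+ p) C (a N.+ j))))
    ≡⟨ sumTo-cong (suc s) (λ j _ → term j) ⟩
  sumTo (suc s) (λ j → + ((a N.+ p) C a) Z.* (sgn j Z.* + (p C j)))
    ≡⟨ sym (sumTo-*ˡ (suc s) (+ ((a N.+ p) C a)) (λ j → sgn j Z.* + (p C j))) ⟩
  + ((a N.+ p) C a) Z.* sumTo (suc s) (λ j → sgn j Z.* + (p C j)) ∎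
  where
  term : ∀ j → sgn j Z.* (+ ((a N.+ j) C a) Z.* + ((a N.+ p) C (a N.+ j))) ≡ + ((a N.+ p) C a) Z.* (sgn j Z.* + (p C j))
  term j = begin
    sgn j Z.* (+ ((a N.+ j) C a) Z.* + ((a N.+ p) C (a N.+ j)))
      ≡⟨ cong (sgn j Z.*_) (sym (Zₚ.pos-* ((a N.+ j) C a) ((a N.+ p) C (a N.+ j)))) ⟩
    sgn j Z.* + (((a N.+ j) C a) N.* ((a N.+ p) C (a N.+ j)))
      ≡⟨ cong (λ u → sgn j Z.* + u) (C-trinomial a p j) ⟩
    sgn j Z.* + (((a N.+ p) C a) N.* (p C j))
      ≡⟨ cong (sgn j Z.*_) (Zₚ.pos-* ((a N.+ p) C a) (p C j)) ⟩
    sgn j Z.* (+ ((a N.+ p) C a) Z.* + (p C j))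
      ≡⟨ reassoc (sgn j) (+ ((a N.+ p) C a)) (+ (p C j)) ⟩
    + ((a N.+ p) C a) Z.* (sgn j Z.* + (p C j)) ∎

inversion-C-≡ : ∀ a s → binomial-inversion a s (a C_) ≡ + 1
inversion-C-≡ a s = begin
  binomial-inversion a s (a C_)
    ≡⟨ cong (λ z → binomial-inversion a s (z C_)) (sym (Nₚ.+-identityʳ a)) ⟩
  binomial-inversion a s ((a N.+ 0) C_)
    ≡⟨ inversion-C-+ a s 0 ⟩
  + ((a N.+ 0) C a) Z.* sumTo (suc s) (λ j → sgn j Z.* + (0 C j))
    ≡⟨ cong₂ (λ u v → + u Z.* v) (trans (cong (_C a) (Nₚ.+-identityʳ a)) (nCn≡1 a)) (sum-alternating-C-zero s) ⟩
  + 1 ∎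

-- For z > a the sum runs through a full alternating row of positive index; for z < a every term
-- contains a vanishing binomial.
inversion-C-≢ : ∀ a s z → z ≤ a N.+ s → z ≢ a → binomial-inversion a s (z C_) ≡ + 0
inversion-C-≢ a s z z≤a+s z≢a with a N.≤? z
... | yes a≤z = begin
  binomial-inversion a s (z C_)
    ≡⟨ cong (λ y → binomial-inversion a s (y C_)) z≡ ⟩
  binomial-inversion a s ((a N.+ suc p) C_)
    ≡⟨ inversion-C-+ a s (suc p) ⟩
  + ((a N.+ suc p) C a) Z.* sumTo (suc s) (λ j → sgn j Z.* + (suc p C j))
    ≡⟨ cong (+ ((a N.+ suc p) C a) Z.*_) (sum-alternating-C-suc p s) ⟩
  + ((a N.+ suc p) C a) Z.* (sgn s Z.* + (p C s))
    ≡⟨ cong (λ u → + ((a N.+ suc p) C a) Z.* (sgn s Z.* + u)) (k>n⇒nCk≡0 p<s) ⟩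
  + ((a N.+ suc p) C a) Z.* (sgn s Z.* + 0)
    ≡⟨ cong (+ ((a N.+ suc p) C a) Z.*_) (Zₚ.*-zeroʳ (sgn s)) ⟩
  + ((a N.+ suc p) C a) Z.* + 0
    ≡⟨ Zₚ.*-zeroʳ (+ ((a N.+ suc p) C a)) ⟩
  + 0 ∎
  where
  a<z : a < z
  a<z = Nₚ.≤∧≢⇒< a≤z (z≢a ∘ sym)
  p : ℕ
  p = z ∸ suc a
  z≡ : z ≡ a N.+ suc p
  z≡ = trans (sym (Nₚ.m+[n∸m]≡n a<z)) (sym (Nₚ.+-suc a p))
  -- The only use of the bound on z: it ensures that the sum reaches the end of the row.
  p<s : p < s
  p<s = Nₚ.+-cancelˡ-≤ a (suc p) s (subst (_≤ a N.+ s) z≡ z≤a+s)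
... | no  a≰z = begin
  binomial-inversion a s (z C_)
    ≡⟨ sumTo-cong (suc s) (λ j _ → term j) ⟩
  sumTo (suc s) (λ _ → + 0)
    ≡⟨ sumTo-zero (suc s) ⟩
  + 0 ∎
  where
  term : ∀ j → sgn j Z.* (+ ((a N.+ j) C a) Z.* + (z C (a N.+ j))) ≡ + 0
  term j = begin
    sgn j Z.* (+ ((a N.+ j) C a) Z.* + (z C (a N.+ j)))
      ≡⟨ cong (λ u → sgn j Z.* (+ ((a N.+ j) C a) Z.* + u)) (k>n⇒nCk≡0 (Nₚ.<-≤-trans (Nₚ.≰⇒> a≰z) (Nₚ.m≤m+n a j))) ⟩
    sgn j Z.* (+ ((a N.+ j) C a) Z.* + 0)
      ≡⟨ cong (sgn j Z.*_) (Zₚ.*-zeroʳ (+ ((a N.+ j) C a))) ⟩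
    sgn j Z.* + 0
      ≡⟨ Zₚ.*-zeroʳ (sgn j) ⟩
    + 0 ∎

inversion-+ : ∀ a s (f g : ℕ → ℕ) →
  binomial-inversion a s (λ t → f t N.+ g t) ≡ binomial-inversion a s f Z.+ binomial-inversion a s g
inversion-+ a s f g = trans
  (sumTo-cong (suc s) (λ j _ → distrib (sgn j) (+ ((a N.+ j) C a)) (+ f (a N.+ j)) (+ g (a N.+ j))))
  (sumTo-+ (suc s) _ _)
  where
  distrib : ∀ x y u v → x Z.* (y Z.* (u Z.+ v)) ≡ x Z.* (y Z.* u) Z.+ x Z.* (y Z.* v)
  distrib = ZS.solve-∀

-- The inversion is additive in the moments, and on the moments of a single element it is the
-- indicator of z x = a.
count-by-moments : ∀ {A : Set} (z : A → ℕ) a s (xs : List A) → All (λ x → z x ≤ a N.+ s) xs →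
  + length (filter (λ x → z x N.≟ a) xs) ≡ binomial-inversion a s (λ t → sum (map (λ x → z x C t) xs))
count-by-moments z a s []       []         = sym (trans (sumTo-cong (suc s) (λ j _ → term j)) (sumTo-zero (suc s)))
  where
  term : ∀ j → sgn j Z.* (+ ((a N.+ j) C a) Z.* + 0) ≡ + 0
  term j = trans (cong (sgn j Z.*_) (Zₚ.*-zeroʳ (+ ((a N.+ j) C a)))) (Zₚ.*-zeroʳ (sgn j))
count-by-moments z a s (x ∷ xs) (zx≤ ∷ ≤s) = trans head-split (sym (inversion-+ a s (z x C_) (λ t → sum (map (λ y → z y C t) xs))))
  where
  IH = count-by-moments z a s xs ≤s
  rest = binomial-inversion a s (λ t → sum (map (λ y → z y C t) xs))
  head-split : + length (filter (λ y → z y N.≟ a) (x ∷ xs)) ≡ binomial-inversion a s (z x C_) Z.+ rest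
  head-split with z x N.≟ a
  ... | yes refl = trans (cong (λ ys → + length ys) (filter-accept (λ y → z y N.≟ a) refl))
                         (cong₂ Z._+_ (sym (inversion-C-≡ a s)) IH)
  ... | no  z≢a  = trans (cong (λ ys → + length ys) (filter-reject (λ y → z y N.≟ a) z≢a))
    (trans IH (trans (sym (Zₚ.+-identityˡ rest)) (cong (Z._+ rest) (sym (inversion-C-≢ a s (z x) zx≤ z≢a)))))

-- Sums and cardinalities of lists, and double counting

length-cong : ∀ {A : Set} {xs ys : List A} → Unique xs → Unique ys →
  (∀ {x} → x ∈ xs → x ∈ ys) → (∀ {x} → x ∈ ys → x ∈ xs) → length xs ≡ length ys
length-cong uxs uys ⊆ ⊇ = ↭-length (∼bag⇒↭ (unique∧set⇒bag uxs uys (mk⇔ ⊆ ⊇)))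

sum-map-+ : ∀ {A : Set} (f g : A → ℕ) xs → sum (map (λ x → f x N.+ g x) xs) ≡ sum (map f xs) N.+ sum (map g xs)
sum-map-+ f g []       = refl
sum-map-+ f g (x ∷ xs) = trans (cong (f x N.+ g x N.+_) (sum-map-+ f g xs)) (shuffle (f x) (g x) (sum (map f xs)) (sum (map g xs)))
  where
  shuffle : ∀ a b c d → (a N.+ b) N.+ (c N.+ d) ≡ (a N.+ c) N.+ (b N.+ d)
  shuffle = NS.solve-∀

sum-map-cong : ∀ {A : Set} {f g : A → ℕ} → (∀ x → f x ≡ g x) → ∀ xs → sum (map f xs) ≡ sum (map g xs)
sum-map-cong f≡g []       = refl
sum-map-cong f≡g (x ∷ xs) = cong₂ N._+_ (f≡g x) (sum-map-cong f≡g xs)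

sum-map-const : ∀ {A : Set} c (xs : List A) → sum (map (λ _ → c) xs) ≡ length xs N.* c
sum-map-const c []       = refl
sum-map-const c (x ∷ xs) = cong (c N.+_) (sum-map-const c xs)

sum-map-*ʳ : ∀ {A : Set} (f : A → ℕ) c xs → sum (map (λ x → f x N.* c) xs) ≡ sum (map f xs) N.* c
sum-map-*ʳ f c []       = refl
sum-map-*ʳ f c (x ∷ xs) = trans (cong (f x N.* c N.+_) (sum-map-*ʳ f c xs)) (sym (Nₚ.*-distribʳ-+ c (f x) (sum (map f xs))))

length-filter-∷ : ∀ {A : Set} {P : A → Set} (P? : Decidable P) x xs →
  length (filter P? (x ∷ xs)) ≡ length (filter P? (x ∷ [])) N.+ length (filter P? xs)
length-filter-∷ P? x xs with P? x
... | yes _ = refl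
... | no  _ = refl

double-count : ∀ {A B : Set} {R : A → B → Set} (R? : ∀ x y → Dec (R x y)) xs ys →
  sum (map (λ x → length (filter (R? x) ys)) xs) ≡ sum (map (λ y → length (filter (λ x → R? x y) xs)) ys)
double-count R? []       ys = sym (trans (sum-map-const 0 ys) (Nₚ.*-zeroʳ (length ys)))
double-count R? (x ∷ xs) ys = begin
  length (filter (R? x) ys) N.+ sum (map (λ x → length (filter (R? x) ys)) xs)
    ≡⟨ cong₂ N._+_ (singleton ys) (double-count R? xs ys) ⟩
  sum (map (λ y → length (filter (λ x → R? x y) (x ∷ []))) ys) N.+ sum (map (λ y → length (filter (λ x → R? x y) xs)) ys)
    ≡⟨ sym (sum-map-+ _ _ ys) ⟩
  sum (map (λ y → length (filter (λ x → R? x y) (x ∷ [])) N.+ length (filter (λ x → R? x y) xs)) ys)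
    ≡⟨ sum-map-cong (λ y → sym (length-filter-∷ (λ x → R? x y) x xs)) ys ⟩
  sum (map (λ y → length (filter (λ x → R? x y) (x ∷ xs))) ys) ∎
  where
  singleton : ∀ ys → length (filter (R? x) ys) ≡ sum (map (λ y → length (filter (λ x → R? x y) (x ∷ []))) ys)
  singleton []       = refl
  singleton (y ∷ ys) with R? x y
  ... | yes _ = cong suc (singleton ys)
  ... | no  _ = singleton ys

-- Linear algebra over a finite field

lookup-ext : ∀ {A : Set} {n} (x y : Vec A n) → (∀ p → lookup x p ≡ lookup y p) → x ≡ y
lookup-ext []      []      eq = refl
lookup-ext (a ∷ x) (b ∷ y) eq = cong₂ _∷_ (eq zero) (lookup-ext x y (eq ∘ suc))

module LinearAlgebra (F : FiniteField) where
  open FiniteField F using (Carrier; _+_; _*_; -_; 0#; 1#; isCommutativeRing; 0≢1; inverse; _≟_)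

  commutativeRing : CommutativeRing 0ℓ 0ℓ
  commutativeRing = record { isCommutativeRing = isCommutativeRing }

  open CommutativeRing commutativeRing public using
    ( ring; semiring; +-identityˡ; +-identityʳ; +-comm; +-assoc; -‿inverseˡ; -‿inverseʳ
    ; *-identityˡ; *-identityʳ; *-comm; *-assoc; distribˡ; distribʳ; zeroˡ; zeroʳ)
  open Algebra.Properties.Ring ring public using (-‿distribˡ-*)
  open Algebra.Properties.Semiring.Sum semiring using (sum-cong-≗; ∑-distrib-+; ∑-comm; *-distribˡ-sum)
    renaming (sum to ∑)

  -- Taken on functions, so that rows, columns and coefficient families can be paired without
  -- conversion.
  ⟪_,_⟫ : ∀ {n} → (Fin n → Carrier) → (Fin n → Carrier) → Carrier
  ⟪ u , v ⟫ = ∑ (λ p → u p * v p)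

  δ : ∀ {n} → Fin n → Fin n → Carrier
  δ zero    zero    = 1#
  δ zero    (suc _) = 0#
  δ (suc _) zero    = 0#
  δ (suc i) (suc j) = δ i j

  -- The elimination step: `y` inverts the pivot `v`, and subtracting the multiple a y of the pivot
  -- row clears the entry `a`.
  sub-scale-self : ∀ {y v} a → v * y ≡ 1# → a + (- (a * y)) * v ≡ 0#
  sub-scale-self {y} {v} a vy≡1 = begin
    a + (- (a * y)) * v   ≡⟨ cong (λ z → a + z) (sym (-‿distribˡ-* (a * y) v)) ⟩
    a + - (a * y * v)     ≡⟨ cong (λ b → a + - b) (*-assoc a y v) ⟩
    a + - (a * (y * v))   ≡⟨ cong (λ b → a + - (a * b)) (trans (*-comm y v) vy≡1) ⟩
    a + - (a * 1#)        ≡⟨ cong (λ b → a + - b) (*-identityʳ a) ⟩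
    a + - a               ≡⟨ -‿inverseʳ a ⟩
    0#                    ∎

  add-scales-cancel : ∀ {c c′} a b → c + c′ ≡ 0# → (a + c * b) + c′ * b ≡ a
  add-scales-cancel {c} {c′} a b c+c′≡0 = begin
    (a + c * b) + c′ * b   ≡⟨ +-assoc a (c * b) (c′ * b) ⟩
    a + (c * b + c′ * b)   ≡⟨ cong (λ z → a + z) (sym (distribʳ b c c′)) ⟩
    a + (c + c′) * b       ≡⟨ cong (λ e → a + e * b) c+c′≡0 ⟩
    a + 0# * b             ≡⟨ cong (λ z → a + z) (zeroˡ b) ⟩
    a + 0#                 ≡⟨ +-identityʳ a ⟩
    a                      ∎

  pair-cong : ∀ {n} {u u′ v v′ : Fin n → Carrier} → (∀ p → u p ≡ u′ p) → (∀ p → v p ≡ v′ p) →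
    ⟪ u , v ⟫ ≡ ⟪ u′ , v′ ⟫
  pair-cong u≗u′ v≗v′ = sum-cong-≗ (λ p → cong₂ _*_ (u≗u′ p) (v≗v′ p))

  pair-comm : ∀ {n} (u v : Fin n → Carrier) → ⟪ u , v ⟫ ≡ ⟪ v , u ⟫
  pair-comm u v = sum-cong-≗ (λ p → *-comm (u p) (v p))

  pair-linearʳ : ∀ {n} (u v w : Fin n → Carrier) c → ⟪ u , (λ p → v p + c * w p) ⟫ ≡ ⟪ u , v ⟫ + c * ⟪ u , w ⟫
  pair-linearʳ u v w c = begin
    ∑ (λ p → u p * (v p + c * w p))
      ≡⟨ sum-cong-≗ (λ p → trans (distribˡ (u p) (v p) (c * w p)) (cong (λ z → u p * v p + z) (exchange (u p) (w p)))) ⟩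
    ∑ (λ p → u p * v p + c * (u p * w p))
      ≡⟨ ∑-distrib-+ (λ p → u p * v p) (λ p → c * (u p * w p)) ⟩
    ∑ (λ p → u p * v p) + ∑ (λ p → c * (u p * w p))
      ≡⟨ cong (λ z → ⟪ u , v ⟫ + z) (sym (*-distribˡ-sum c (λ p → u p * w p))) ⟩
    ⟪ u , v ⟫ + c * ⟪ u , w ⟫ ∎
    where
    exchange : ∀ a b → a * (c * b) ≡ c * (a * b)
    exchange a b = trans (sym (*-assoc a c b)) (trans (cong (_* b) (*-comm a c)) (*-assoc c a b))

  pair-linearˡ : ∀ {n} (u v w : Fin n → Carrier) c → ⟪ (λ p → v p + c * w p) , u ⟫ ≡ ⟪ v , u ⟫ + c * ⟪ w , u ⟫
  pair-linearˡ u v w c = trans (pair-comm _ u) (trans (pair-linearʳ u v w c)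
    (cong₂ (λ a b → a + c * b) (pair-comm u v) (pair-comm u w)))

  pair-zeroʳ : ∀ {n} (u v : Fin n → Carrier) → (∀ p → v p ≡ 0#) → ⟪ u , v ⟫ ≡ 0#
  pair-zeroʳ {zero}  u v v≡0 = refl
  pair-zeroʳ {suc n} u v v≡0 = begin
    u zero * v zero + ⟪ u ∘ suc , v ∘ suc ⟫
      ≡⟨ cong₂ (λ a b → u zero * a + b) (v≡0 zero) (pair-zeroʳ (u ∘ suc) (v ∘ suc) (v≡0 ∘ suc)) ⟩
    u zero * 0# + 0#   ≡⟨ +-identityʳ _ ⟩
    u zero * 0#        ≡⟨ zeroʳ (u zero) ⟩
    0#                 ∎

  pair-zeroˡ : ∀ {n} (u v : Fin n → Carrier) → (∀ p → u p ≡ 0#) → ⟪ u , v ⟫ ≡ 0#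
  pair-zeroˡ u v u≡0 = trans (pair-comm u v) (pair-zeroʳ v u u≡0)

  pair-δʳ : ∀ {n} (u : Fin n → Carrier) p → ⟪ u , δ p ⟫ ≡ u p
  pair-δʳ u zero    = begin
    u zero * 1# + ⟪ u ∘ suc , (λ _ → 0#) ⟫
      ≡⟨ cong₂ _+_ (*-identityʳ (u zero)) (pair-zeroʳ (u ∘ suc) (λ _ → 0#) (λ _ → refl)) ⟩
    u zero + 0#  ≡⟨ +-identityʳ (u zero) ⟩
    u zero       ∎
  pair-δʳ u (suc p) = begin
    u zero * 0# + ⟪ u ∘ suc , δ p ⟫  ≡⟨ cong₂ _+_ (zeroʳ (u zero)) (pair-δʳ (u ∘ suc) p) ⟩
    0# + u (suc p)                   ≡⟨ +-identityˡ (u (suc p)) ⟩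
    u (suc p)                        ∎

  δ-sym : ∀ {n} (i j : Fin n) → δ i j ≡ δ j i
  δ-sym zero    zero    = refl
  δ-sym zero    (suc _) = refl
  δ-sym (suc _) zero    = refl
  δ-sym (suc i) (suc j) = δ-sym i j

  -- Associativity of the product of row, matrix and column, by exchanging the two sums.
  pair-assoc : ∀ {m n} (u : Fin n → Carrier) (c : Fin m → Carrier) (g : Fin m → Fin n → Carrier) →
    ⟪ u , (λ p → ⟪ c , (λ i → g i p) ⟫) ⟫ ≡ ⟪ c , (λ i → ⟪ u , g i ⟫) ⟫
  pair-assoc u c g = begin
    ∑ (λ p → u p * ∑ (λ i → c i * g i p))
      ≡⟨ sum-cong-≗ (λ p → *-distribˡ-sum (u p) (λ i → c i * g i p)) ⟩
    ∑ (λ p → ∑ (λ i → u p * (c i * g i p)))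
      ≡⟨ ∑-comm (λ p i → u p * (c i * g i p)) ⟩
    ∑ (λ i → ∑ (λ p → u p * (c i * g i p)))
      ≡⟨ sum-cong-≗ (λ i → trans (sum-cong-≗ (λ p → exchange (u p) (c i) (g i p)))
                                 (sym (*-distribˡ-sum (c i) (λ p → u p * g i p)))) ⟩
    ∑ (λ i → c i * ∑ (λ p → u p * g i p)) ∎
    where
    exchange : ∀ a b d → a * (b * d) ≡ b * (a * d)
    exchange a b d = trans (sym (*-assoc a b d)) (trans (cong (_* d) (*-comm a b)) (*-assoc b a d))

  Biorthogonal : ∀ {r n} → (Fin r → Fin n → Carrier) → (Fin r → Fin n → Carrier) → Set
  Biorthogonal v g = ∀ i j → ⟪ v i , g j ⟫ ≡ δ i j

  Dependent : ∀ {r n} → (Fin r → Fin n → Carrier) → Set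
  Dependent {r} v = Σ (Fin r → Carrier) λ c → (∃ λ i → c i ≢ 0#) × (∀ p → ⟪ c , (λ i → v i p) ⟫ ≡ 0#)

  -- Gaussian elimination. A biorthogonal family is a certificate of independence that field homomorphisms preserve.
  biorthogonal-or-dependent : ∀ {n} r (v : Fin r → Fin n → Carrier) → (∃ λ g → Biorthogonal v g) ⊎ Dependent v
  biorthogonal-or-dependent zero    v = inj₁ ((λ ()) , λ ())
  biorthogonal-or-dependent {n} (suc r) v with Finₚ.any? (λ p → ¬? (v zero p ≟ 0#))
  -- No pivot means that the first vector is zero, so its own unit coefficient is a dependency.
  ... | no  v₀≡0 = inj₂ (δ zero , (zero , 0≢1 ∘ sym) , λ p →
          trans (pair-comm (δ zero) (λ i → v i p)) (trans (pair-δʳ (λ i → v i p) zero)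
            (decidable-stable (v zero p ≟ 0#) (λ v₀p≢0 → v₀≡0 (p , v₀p≢0)))))
  ... | yes (p , v₀p≢0) with inverse (v zero p) v₀p≢0
  ...   | y , v₀p*y≡1 = extend (biorthogonal-or-dependent r w)
    where
    -- The multipliers that clear column `p`; `w` is the remaining family after clearing.
    ρ : Fin r → Carrier
    ρ i = v (suc i) p * y
    w : Fin r → Fin n → Carrier
    w i q = v (suc i) q + (- ρ i) * v zero q
    w≡0 : ∀ i → w i p ≡ 0#
    w≡0 i = sub-scale-self (v (suc i) p) v₀p*y≡1
    extend : (∃ λ g → Biorthogonal w g) ⊎ Dependent w → (∃ λ g → Biorthogonal v g) ⊎ Dependent v
    extend (inj₂ (c , (i , ci≢0) , cw≡0)) = inj₂ (c′ , (suc i , ci≢0) , c′v≡0)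
      where
      -- The multiples of `v zero` subtracted in forming `w` are collected into its coefficient.
      c′ : Fin (suc r) → Carrier
      c′ zero    = ⟪ c , (λ i → - ρ i) ⟫
      c′ (suc i) = c i
      c′v≡0 : ∀ q → ⟪ c′ , (λ i → v i q) ⟫ ≡ 0#
      c′v≡0 q = begin
        ⟪ c , (λ i → - ρ i) ⟫ * v zero q + ⟪ c , (λ i → v (suc i) q) ⟫
          ≡⟨ trans (+-comm _ _) (cong (λ z → ⟪ c , (λ i → v (suc i) q) ⟫ + z) (*-comm _ _)) ⟩
        ⟪ c , (λ i → v (suc i) q) ⟫ + v zero q * ⟪ c , (λ i → - ρ i) ⟫
          ≡⟨ sym (pair-linearʳ c (λ i → v (suc i) q) (λ i → - ρ i) (v zero q)) ⟩
        ⟪ c , (λ i → v (suc i) q + v zero q * - ρ i) ⟫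
          ≡⟨ pair-cong {u = c} (λ _ → refl) (λ i → cong (λ z → v (suc i) q + z) (*-comm (v zero q) (- ρ i))) ⟩
        ⟪ c , (λ i → w i q) ⟫
          ≡⟨ cw≡0 q ⟩
        0# ∎
    extend (inj₁ (g , wg≡δ)) = inj₁ (g″ , vg″≡δ)
      where
      -- Correcting `g j` at the pivot column alone makes it orthogonal to `v zero`, and its
      -- pairings with `w` do not change because `w` is zero in that column.
      α : Fin r → Carrier
      α j = - (⟪ v zero , g j ⟫ * y)
      g′ : Fin r → Fin n → Carrier
      g′ j q = g j q + α j * δ p q
      pair-g′ : ∀ u j → ⟪ u , g′ j ⟫ ≡ ⟪ u , g j ⟫ + α j * u p
      pair-g′ u j = trans (pair-linearʳ u (g j) (δ p) (α j)) (cong (λ a → ⟪ u , g j ⟫ + α j * a) (pair-δʳ u p))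
      v₀g′≡0 : ∀ j → ⟪ v zero , g′ j ⟫ ≡ 0#
      v₀g′≡0 j = trans (pair-g′ (v zero) j) (sub-scale-self ⟪ v zero , g j ⟫ v₀p*y≡1)
      vg′≡δ : ∀ i j → ⟪ v (suc i) , g′ j ⟫ ≡ δ i j
      vg′≡δ i j = begin
        ⟪ v (suc i) , g′ j ⟫
          ≡⟨ sym (+-identityʳ _) ⟩
        ⟪ v (suc i) , g′ j ⟫ + 0#
          ≡⟨ cong (λ z → ⟪ v (suc i) , g′ j ⟫ + z) (sym (trans (cong (- ρ i *_) (v₀g′≡0 j)) (zeroʳ _))) ⟩
        ⟪ v (suc i) , g′ j ⟫ + - ρ i * ⟪ v zero , g′ j ⟫
          ≡⟨ sym (pair-linearˡ (g′ j) (v (suc i)) (v zero) (- ρ i)) ⟩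
        ⟪ w i , g′ j ⟫
          ≡⟨ pair-g′ (w i) j ⟩
        ⟪ w i , g j ⟫ + α j * w i p
          ≡⟨ cong₂ _+_ (wg≡δ i j) (trans (cong (α j *_) (w≡0 i)) (zeroʳ _)) ⟩
        δ i j + 0#
          ≡⟨ +-identityʳ _ ⟩
        δ i j ∎
      -- The functional y δ_p takes the value 1 on `v zero` and ρ i on `v (suc i)`; subtracting the
      -- ρ j multiples of `g′ j` removes the latter without touching the former.
      g₀ : Fin n → Carrier
      g₀ q = ⟪ (λ j → - ρ j) , (λ j → g′ j q) ⟫ + y * δ p q
      pair-g₀ : ∀ u → ⟪ u , g₀ ⟫ ≡ ⟪ (λ j → - ρ j) , (λ j → ⟪ u , g′ j ⟫) ⟫ + y * u p
      pair-g₀ u = trans (pair-linearʳ u (λ q → ⟪ (λ j → - ρ j) , (λ j → g′ j q) ⟫) (δ p) y)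
        (cong₂ (λ a b → a + y * b) (pair-assoc u (λ j → - ρ j) g′) (pair-δʳ u p))
      g″ : Fin (suc r) → Fin n → Carrier
      g″ zero    = g₀
      g″ (suc j) = g′ j
      vg″≡δ : Biorthogonal v g″
      vg″≡δ zero    (suc j) = v₀g′≡0 j
      vg″≡δ (suc i) (suc j) = vg′≡δ i j
      vg″≡δ zero    zero    = begin
        ⟪ v zero , g₀ ⟫
          ≡⟨ pair-g₀ (v zero) ⟩
        ⟪ (λ j → - ρ j) , (λ j → ⟪ v zero , g′ j ⟫) ⟫ + y * v zero p
          ≡⟨ cong₂ _+_ (pair-zeroʳ (λ j → - ρ j) _ v₀g′≡0) (trans (*-comm y (v zero p)) v₀p*y≡1) ⟩
        0# + 1#
          ≡⟨ +-identityˡ 1# ⟩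
        1# ∎
      vg″≡δ (suc i) zero    = begin
        ⟪ v (suc i) , g₀ ⟫
          ≡⟨ pair-g₀ (v (suc i)) ⟩
        ⟪ (λ j → - ρ j) , (λ j → ⟪ v (suc i) , g′ j ⟫) ⟫ + y * v (suc i) p
          ≡⟨ cong₂ _+_ (trans (pair-cong {u = λ j → - ρ j} (λ _ → refl) (vg′≡δ i)) (pair-δʳ (λ j → - ρ j) i)) (*-comm y _) ⟩
        - ρ i + ρ i
          ≡⟨ -‿inverseˡ (ρ i) ⟩
        0# ∎

  dot-pairing : ∀ {n} (x y : Vect F n) → dot F x y ≡ ⟪ lookup x , lookup y ⟫
  dot-pairing []      []      = refl
  dot-pairing (a ∷ x) (b ∷ y) = cong (λ z → a * b + z) (dot-pairing x y)

  lookup-0v : ∀ {n} (p : Fin n) → lookup (0v F) p ≡ 0#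
  lookup-0v p = Vecₚ.lookup-replicate p 0#

  lookup-⊕ : ∀ {n} (x y : Vect F n) p → lookup (_⊕_ F x y) p ≡ lookup x p + lookup y p
  lookup-⊕ x y p = Vecₚ.lookup-zipWith _+_ p x y

  lookup-⊙ : ∀ {n} a (x : Vect F n) p → lookup (_⊙_ F a x) p ≡ a * lookup x p
  lookup-⊙ a x p = Vecₚ.lookup-map p (a *_) x

  lookup-axpy : ∀ {n} (x y : Vect F n) c p → lookup (_⊕_ F x (_⊙_ F c y)) p ≡ lookup x p + c * lookup y p
  lookup-axpy x y c p = trans (lookup-⊕ x (_⊙_ F c y) p) (cong (λ z → lookup x p + z) (lookup-⊙ c y p))

  axpy-cancel : ∀ {n c c′} (x y : Vect F n) → c + c′ ≡ 0# → _⊕_ F (_⊕_ F x (_⊙_ F c y)) (_⊙_ F c′ y) ≡ x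
  axpy-cancel {c = c} {c′} x y c+c′≡0 = lookup-ext _ x λ p → begin
    lookup (_⊕_ F (_⊕_ F x (_⊙_ F c y)) (_⊙_ F c′ y)) p
      ≡⟨ lookup-axpy (_⊕_ F x (_⊙_ F c y)) y c′ p ⟩
    lookup (_⊕_ F x (_⊙_ F c y)) p + c′ * lookup y p
      ≡⟨ cong (_+ c′ * lookup y p) (lookup-axpy x y c p) ⟩
    (lookup x p + c * lookup y p) + c′ * lookup y p
      ≡⟨ add-scales-cancel (lookup x p) (lookup y p) c+c′≡0 ⟩
    lookup x p ∎

  lookup-lincomb : ∀ {n} r c (v : Fin r → Vect F n) p → lookup (lincomb F r c v) p ≡ ⟪ c , (λ j → lookup (v j) p) ⟫
  lookup-lincomb zero    c v p = lookup-0v p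
  lookup-lincomb (suc r) c v p = begin
    lookup (_⊕_ F (_⊙_ F (c zero) (v zero)) (lincomb F r (c ∘ suc) (v ∘ suc))) p
      ≡⟨ lookup-⊕ (_⊙_ F (c zero) (v zero)) (lincomb F r (c ∘ suc) (v ∘ suc)) p ⟩
    lookup (_⊙_ F (c zero) (v zero)) p + lookup (lincomb F r (c ∘ suc) (v ∘ suc)) p
      ≡⟨ cong₂ _+_ (lookup-⊙ (c zero) (v zero) p) (lookup-lincomb r (c ∘ suc) (v ∘ suc) p) ⟩
    c zero * lookup (v zero) p + ⟪ c ∘ suc , (λ j → lookup (v (suc j)) p) ⟫ ∎

  ≡0v : ∀ {n} (x : Vect F n) → (∀ p → lookup x p ≡ 0#) → x ≡ 0v F
  ≡0v x x≡0 = lookup-ext x (0v F) (λ p → trans (x≡0 p) (sym (lookup-0v p)))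

  ≢0v : ∀ {n} (x : Vect F n) → x ≢ 0v F → ∃ λ p → lookup x p ≢ 0#
  ≢0v x x≢0 with Finₚ.any? (λ p → ¬? (lookup x p ≟ 0#))
  ... | yes found = found
  ... | no  none  = contradiction
          (≡0v x (λ p → decidable-stable (lookup x p ≟ 0#) (λ xp≢0 → none (p , xp≢0)))) x≢0

-- Transport of pairings along a field extension

module _ {K : FiniteField} {m : ℕ} (E : Extension K m) where
  open Extension E
  private
    module K = FiniteField K
    module L = FiniteField L
    module LK = LinearAlgebra K
    module LL = LinearAlgebra L

  -- Additivity gives ι 0 + ι 0 = ι 0, from which one ι 0 is cancelled.
  ι-0 : ι K.0# ≡ L.0#
  ι-0 = begin
    ι K.0#                                    ≡⟨ sym (LL.+-identityʳ _) ⟩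
    ι K.0# L.+ L.0#                           ≡⟨ cong (ι K.0# L.+_) (sym (LL.-‿inverseʳ (ι K.0#))) ⟩
    ι K.0# L.+ (ι K.0# L.+ L.- ι K.0#)        ≡⟨ sym (LL.+-assoc _ _ _) ⟩
    ι K.0# L.+ ι K.0# L.+ L.- ι K.0#          ≡⟨ cong (L._+ L.- ι K.0#) (sym (ι-+ K.0# K.0#)) ⟩
    ι (K.0# K.+ K.0#) L.+ L.- ι K.0#          ≡⟨ cong (λ a → ι a L.+ L.- ι K.0#) (LK.+-identityʳ K.0#) ⟩
    ι K.0# L.+ L.- ι K.0#                     ≡⟨ LL.-‿inverseʳ _ ⟩
    L.0#                                      ∎
    where open ≡-Reasoning

  -- A unit is sent to a unit, because products and 1 are preserved.
  ι-≢0 : ∀ {a} → a ≢ K.0# → ι a ≢ L.0#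
  ι-≢0 {a} a≢0 ιa≡0 with K.inverse a a≢0
  ... | b , ab≡1 = L.0≢1 (begin
    L.0#             ≡⟨ sym (LL.zeroˡ (ι b)) ⟩
    L.0# L.* ι b     ≡⟨ cong (L._* ι b) (sym ιa≡0) ⟩
    ι a L.* ι b      ≡⟨ sym (ι-* a b) ⟩
    ι (a K.* b)      ≡⟨ cong ι ab≡1 ⟩
    ι K.1#           ≡⟨ ι-1 ⟩
    L.1#             ∎)
    where open ≡-Reasoning

  ι-pair : ∀ {n} (u v : Fin n → K.Carrier) → ι LK.⟪ u , v ⟫ ≡ LL.⟪ ι ∘ u , ι ∘ v ⟫
  ι-pair {zero}  u v = ι-0
  ι-pair {suc n} u v = trans (ι-+ _ _) (cong₂ L._+_ (ι-* (u zero) (v zero)) (ι-pair (u ∘ suc) (v ∘ suc)))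

  ι-δ : ∀ {n} (i j : Fin n) → ι (LK.δ i j) ≡ LL.δ i j
  ι-δ zero    zero    = ι-1
  ι-δ zero    (suc _) = ι-0
  ι-δ (suc _) zero    = ι-0
  ι-δ (suc i) (suc j) = ι-δ i j

  ι-biorthogonal : ∀ {r n} {v g : Fin r → Fin n → K.Carrier} → LK.Biorthogonal v g →
    LL.Biorthogonal (λ i → ι ∘ v i) (λ i → ι ∘ g i)
  ι-biorthogonal {v = v} {g} vg≡δ i j = trans (sym (ι-pair (v i) (g j))) (trans (cong ι (vg≡δ i j)) (ι-δ i j))

-- Sets of positions, zeros and weights

length-cartesianProductWith : ∀ {A B D : Set} (f : A → B → D) xs ys →
  length (cartesianProductWith f xs ys) ≡ length xs N.* length ys
length-cartesianProductWith f []       ys = refl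
length-cartesianProductWith f (x ∷ xs) ys = trans (length-++ (map (f x) ys))
  (cong₂ N._+_ (length-map (f x) ys) (length-cartesianProductWith f xs ys))

length-filter-map : ∀ {A B : Set} {P : B → Set} {Q : A → Set} (P? : Decidable P) (Q? : Decidable Q) (f : A → B) →
  (∀ x → P (f x) → Q x) → (∀ x → Q x → P (f x)) → ∀ xs → length (filter P? (map f xs)) ≡ length (filter Q? xs)
length-filter-map P? Q? f P⇒Q Q⇒P []       = refl
length-filter-map P? Q? f P⇒Q Q⇒P (x ∷ xs) with Q? x | P? (f x)
... | yes _ | yes _  = cong suc (length-filter-map P? Q? f P⇒Q Q⇒P xs)
... | yes q | no  ¬p = contradiction (Q⇒P x q) ¬p
... | no ¬q | yes p  = contradiction (P⇒Q x p) ¬q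
... | no  _ | no  _  = length-filter-map P? Q? f P⇒Q Q⇒P xs

-- The t-subsets of n positions, one decision per position. Each subset has exactly one code, and
-- the two constructors for a successor are the two summands of Pascal's rule.
data Positions : ℕ → ℕ → Set where
  done : Positions 0 0
  skip : ∀ {n t} → Positions n t → Positions (suc n) t
  keep : ∀ {n t} → Positions n t → Positions (suc n) (suc t)

embed : ∀ {n t} → Positions n t → Fin t → Fin n
embed (skip T) i       = suc (embed T i)
embed (keep T) zero    = zero
embed (keep T) (suc i) = suc (embed T i)

positions : ∀ n t → List (Positions n t)
positions zero    zero    = done ∷ []
positions zero    (suc t) = []
positions (suc n) zero    = map skip (positions n zero)
positions (suc n) (suc t) = map skip (positions n (suc t)) ++ map keep (positions n t)

length-positions : ∀ n t → length (positions n t) ≡ n C t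
length-positions zero    zero    = refl
length-positions zero    (suc t) = sym (k>n⇒nCk≡0 {0} {suc t} (s≤s z≤n))
length-positions (suc n) zero    = trans (length-map skip (positions n zero)) (length-positions n zero)
length-positions (suc n) (suc t) = begin
  length (map skip (positions n (suc t)) ++ map keep (positions n t))
    ≡⟨ length-++ (map skip (positions n (suc t))) ⟩
  length (map skip (positions n (suc t))) N.+ length (map keep (positions n t))
    ≡⟨ cong₂ N._+_ (trans (length-map skip (positions n (suc t))) (length-positions n (suc t)))
                   (trans (length-map keep (positions n t)) (length-positions n t)) ⟩
  n C suc t N.+ n C t
    ≡⟨ Nₚ.+-comm (n C suc t) (n C t) ⟩
  n C t N.+ n C suc t
    ≡⟨ nCk+nC[k+1]≡[n+1]C[k+1] n t ⟩
  suc n C suc t ∎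
  where open ≡-Reasoning

module Vectors (F : FiniteField) where
  open FiniteField F using (Carrier; _+_; _*_; 0#; 1#; 0≢1; _≟_; elements; unique; complete)
  open LinearAlgebra F

  vectors : ∀ n → List (Vect F n)
  vectors zero    = [] ∷ []
  vectors (suc n) = cartesianProductWith _∷_ elements (vectors n)

  vectors-unique : ∀ n → Unique (vectors n)
  vectors-unique zero    = [] ∷ []
  vectors-unique (suc n) = Uniqueₚ.cartesianProductWith⁺ _∷_ Vecₚ.∷-injective unique (vectors-unique n)

  ∈-vectors : ∀ {n} (x : Vect F n) → x ∈ vectors n
  ∈-vectors []      = here refl
  ∈-vectors (a ∷ x) = ∈-cartesianProductWith⁺ _∷_ (complete a) (∈-vectors x)

  length-vectors : ∀ n → length (vectors n) ≡ size F ^ n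
  length-vectors zero    = refl
  length-vectors (suc n) = trans (length-cartesianProductWith _∷_ elements (vectors n)) (cong (size F N.*_) (length-vectors n))

  1<size : 1 < size F
  1<size with elements | complete 0# | complete 1#
  ... | _ ∷ []    | here 0≡x | here 1≡x = contradiction (trans 0≡x (sym 1≡x)) 0≢1
  ... | _ ∷ _ ∷ _ | _        | _        = s≤s (s≤s z≤n)

  size-nonZero : NonZero (size F)
  size-nonZero = N.>-nonZero (Nₚ.<⇒≤ 1<size)

  zeros : ∀ {n} → Vect F n → ℕ
  zeros []      = 0
  zeros (a ∷ x) with a ≟ 0#
  ... | yes _ = suc (zeros x)
  ... | no  _ = zeros x

  wt+zeros : ∀ {n} (x : Vect F n) → wt F x N.+ zeros x ≡ n
  wt+zeros []      = refl
  wt+zeros (a ∷ x) with a ≟ 0#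
  ... | yes _ = trans (Nₚ.+-suc (wt F x) (zeros x)) (cong suc (wt+zeros x))
  ... | no  _ = cong suc (wt+zeros x)

  wt-positive : ∀ {n} (x : Vect F n) p → lookup x p ≢ 0# → 1 ≤ wt F x
  wt-positive (a ∷ x) p       xp≢0 with a ≟ 0#
  wt-positive (a ∷ x) p       xp≢0 | no  _   = s≤s z≤n
  wt-positive (a ∷ x) zero    xp≢0 | yes a≡0 = contradiction a≡0 xp≢0
  wt-positive (a ∷ x) (suc p) xp≢0 | yes _   = wt-positive x p xp≢0

  wt-0v : ∀ n → wt F (0v F {n}) ≡ 0
  wt-0v zero    = refl
  wt-0v (suc n) with 0# ≟ 0#
  ... | yes _   = wt-0v n
  ... | no  0≢0 = contradiction refl 0≢0

  VanishesOn : ∀ {n t} → Positions n t → Vect F n → Set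
  VanishesOn T x = ∀ i → lookup x (embed T i) ≡ 0#

  vanishesOn? : ∀ {n t} (T : Positions n t) x → Dec (VanishesOn T x)
  vanishesOn? T x = Finₚ.all? (λ i → lookup x (embed T i) ≟ 0#)

  vanishesOn-keep : ∀ {n t} (T : Positions n t) {a x} → a ≡ 0# → VanishesOn T x → VanishesOn (keep T) (a ∷ x)
  vanishesOn-keep T a≡0 Tx≡0 zero    = a≡0
  vanishesOn-keep T a≡0 Tx≡0 (suc i) = Tx≡0 i

  -- The sets counted are the t-subsets of the zero set. The induction is Pascal's rule; the `keep`
  -- half is empty when the head is nonzero.
  count-vanishing : ∀ {n} (x : Vect F n) t → length (filter (λ T → vanishesOn? T x) (positions n t)) ≡ zeros x C t
  count-vanishing []      zero    = refl
  count-vanishing []      (suc t) = sym (k>n⇒nCk≡0 {0} {suc t} (s≤s z≤n))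
  count-vanishing {suc n} (a ∷ x) zero    = trans
    (length-filter-map (λ T → vanishesOn? T (a ∷ x)) (λ T → vanishesOn? T x) skip (λ _ h → h) (λ _ h → h) (positions n zero))
    (count-vanishing x zero)
  count-vanishing {suc n} (a ∷ x) (suc t) = begin
    length (filter P? (map skip (positions n (suc t)) ++ map keep (positions n t)))
      ≡⟨ cong length (filter-++ P? (map skip (positions n (suc t))) (map keep (positions n t))) ⟩
    length (filter P? (map skip (positions n (suc t))) ++ filter P? (map keep (positions n t)))
      ≡⟨ length-++ (filter P? (map skip (positions n (suc t)))) ⟩
    length (filter P? (map skip (positions n (suc t)))) N.+ length (filter P? (map keep (positions n t)))
      ≡⟨ cong₂ N._+_
           (trans (length-filter-map P? (λ T → vanishesOn? T x) skip (λ _ h → h) (λ _ h → h) (positions n (suc t)))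
                  (count-vanishing x (suc t)))
           refl ⟩
    zeros x C suc t N.+ length (filter P? (map keep (positions n t)))
      ≡⟨ keep-part ⟩
    zeros (a ∷ x) C suc t ∎
    where
    P? : ∀ {t} (T : Positions (suc n) t) → Dec (VanishesOn T (a ∷ x))
    P? T = vanishesOn? T (a ∷ x)
    none : a ≢ 0# → ∀ Ts → length (filter P? (map (keep {n} {t}) Ts)) ≡ 0
    none a≢0 []       = refl
    none a≢0 (T ∷ Ts) = trans (cong length (filter-reject P? (λ h → a≢0 (h zero)))) (none a≢0 Ts)
    keep-part : zeros x C suc t N.+ length (filter P? (map keep (positions n t))) ≡ zeros (a ∷ x) C suc t
    keep-part with a ≟ 0#
    ... | yes a≡0 = trans
            (cong (zeros x C suc t N.+_) (trans
              (length-filter-map P? (λ T → vanishesOn? T x) keep (λ _ h → h ∘ suc) (λ T → vanishesOn-keep T a≡0) (positions n t))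
              (count-vanishing x t)))
            (trans (Nₚ.+-comm (zeros x C suc t) (zeros x C t)) (nCk+nC[k+1]≡[n+1]C[k+1] (zeros x) t))
    ... | no  a≢0 = trans (cong (zeros x C suc t N.+_) (none a≢0 (positions n t))) (Nₚ.+-identityʳ _)

  zeroPositions : ∀ {n} (x : Vect F n) → Positions n (zeros x)
  zeroPositions []      = done
  zeroPositions (a ∷ x) with a ≟ 0#
  ... | yes _ = keep (zeroPositions x)
  ... | no  _ = skip (zeroPositions x)

  vanishesOn-zeroPositions : ∀ {n} (x : Vect F n) → VanishesOn (zeroPositions x) x
  vanishesOn-zeroPositions []      ()
  vanishesOn-zeroPositions (a ∷ x) with a ≟ 0#
  ... | yes a≡0 = vanishesOn-keep (zeroPositions x) a≡0 (vanishesOn-zeroPositions x)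
  ... | no  _   = vanishesOn-zeroPositions x

  vanishing-wt : ∀ {n t} (T : Positions n t) x → VanishesOn T x → wt F x N.+ t ≤ n
  vanishing-wt done                     []      _    = z≤n
  vanishing-wt {suc n} {t}     (skip T) (a ∷ x) Tx≡0 with a ≟ 0#
  ... | yes _ = Nₚ.m≤n⇒m≤1+n (vanishing-wt T x Tx≡0)
  ... | no  _ = s≤s (vanishing-wt T x Tx≡0)
  vanishing-wt {suc n} {suc t} (keep T) (a ∷ x) Tx≡0 with a ≟ 0#
  ... | yes _   = subst (_≤ suc n) (sym (Nₚ.+-suc (wt F x) t)) (s≤s (vanishing-wt T x (Tx≡0 ∘ suc)))
  ... | no  a≢0 = contradiction (Tx≡0 zero) a≢0

  -- The position `p` is one zero beyond those in `T`. With t = k it forces the weight below d.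
  vanishing-wt-< : ∀ {n t} (T : Positions n t) x p → VanishesOn T x → lookup x p ≡ 0# →
    (∀ i → embed T i ≢ p) → wt F x N.+ t < n
  vanishing-wt-< {suc n} {t} (skip T) (a ∷ x) p Tx≡0 xp≡0 p∉T with a ≟ 0#
  vanishing-wt-< {suc n} {t} (skip T) (a ∷ x) p       Tx≡0 xp≡0 p∉T | yes _   = s≤s (vanishing-wt T x Tx≡0)
  vanishing-wt-< {suc n} {t} (skip T) (a ∷ x) zero    Tx≡0 xp≡0 p∉T | no  a≢0 = contradiction xp≡0 a≢0
  vanishing-wt-< {suc n} {t} (skip T) (a ∷ x) (suc p) Tx≡0 xp≡0 p∉T | no  _   =
    s≤s (vanishing-wt-< T x p Tx≡0 xp≡0 (λ i i≡p → p∉T i (cong suc i≡p)))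
  vanishing-wt-< {suc n} {suc t} (keep T) (a ∷ x) zero    Tx≡0 xp≡0 p∉T = contradiction refl (p∉T zero)
  vanishing-wt-< {suc n} {suc t} (keep T) (a ∷ x) (suc p) Tx≡0 xp≡0 p∉T with a ≟ 0#
  ... | yes _   = subst (_< suc n) (sym (Nₚ.+-suc (wt F x) t))
                    (s≤s (vanishing-wt-< T x p (Tx≡0 ∘ suc) xp≡0 (λ i i≡p → p∉T (suc i) (cong suc i≡p))))
  ... | no  a≢0 = contradiction (Tx≡0 zero) a≢0

  -- Extension by zero. It turns the coefficients of a dependency among t coordinate functionals
  -- into a word of weight at most t, a candidate for the dual code.
  scatter : ∀ {n t} → Positions n t → (Fin t → Carrier) → Vect F n
  scatter done     c = []
  scatter (skip T) c = 0# ∷ scatter T c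
  scatter (keep T) c = c zero ∷ scatter T (c ∘ suc)

  lookup-scatter : ∀ {n t} (T : Positions n t) c i → lookup (scatter T c) (embed T i) ≡ c i
  lookup-scatter (skip T) c i       = lookup-scatter T c i
  lookup-scatter (keep T) c zero    = refl
  lookup-scatter (keep T) c (suc i) = lookup-scatter T (c ∘ suc) i

  wt-scatter : ∀ {n t} (T : Positions n t) c → wt F (scatter T c) ≤ t
  wt-scatter done     c = z≤n
  wt-scatter (skip T) c with 0# ≟ 0#
  ... | yes _   = wt-scatter T c
  ... | no  0≢0 = contradiction refl 0≢0
  wt-scatter (keep T) c with c zero ≟ 0#
  ... | yes _ = Nₚ.m≤n⇒m≤1+n (wt-scatter T (c ∘ suc))
  ... | no  _ = s≤s (wt-scatter T (c ∘ suc))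

  dot-scatter : ∀ {n t} (T : Positions n t) x c → dot F x (scatter T c) ≡ ⟪ (λ i → lookup x (embed T i)) , c ⟫
  dot-scatter done     []      c = refl
  dot-scatter (skip T) (a ∷ x) c = trans (cong₂ _+_ (zeroʳ a) (dot-scatter T x c)) (+-identityˡ _)
  dot-scatter (keep T) (a ∷ x) c = cong (λ z → a * c zero + z) (dot-scatter T x (c ∘ suc))

-- Near-MDS codes and their lifts

pos-∸1 : ∀ c → .{{NonZero c}} → + (c ∸ 1) ≡ + c - + 1
pos-∸1 c = sym (trans (Zₚ.m-n≡m⊖n c 1) (Zₚ.⊖-≥ (N.>-nonZero⁻¹ c)))

lincomb-closed : ∀ (F : FiniteField) {n} {𝒞 : Code F n} → IsLinear F 𝒞 →
  ∀ r c (v : Fin r → Vect F n) → (∀ j → 𝒞 (v j)) → 𝒞 (lincomb F r c v)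
lincomb-closed F (𝒞0 , _ , _) zero    c v 𝒞v = 𝒞0
lincomb-closed F lin@(𝒞0 , 𝒞⊕ , 𝒞⊙) (suc r) c v 𝒞v =
  𝒞⊕ _ _ (𝒞⊙ (c zero) (v zero) (𝒞v zero)) (lincomb-closed F lin r (c ∘ suc) (v ∘ suc) (𝒞v ∘ suc))

module NMDS {K : FiniteField} {n k : ℕ} {𝒞 : Code K n} (nmds : IsNMDS K n k 𝒞) where
  private
    module K = FiniteField K
    module LK = LinearAlgebra K
    module VK = Vectors K

  d : ℕ
  d = n ∸ k

  linear : IsLinear K 𝒞
  linear = proj₁ nmds

  basis : Fin k → Vect K n
  basis = proj₁ (proj₁ (proj₂ nmds))

  basis-∈ : ∀ j → 𝒞 (basis j)
  basis-∈ = proj₁ (proj₂ (proj₁ (proj₂ nmds)))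

  basis-independent : ∀ c → lincomb K k c basis ≡ 0v K → ∀ j → c j ≡ K.0#
  basis-independent = proj₁ (proj₂ (proj₂ (proj₁ (proj₂ nmds))))

  basis-spans : ∀ x → 𝒞 x → Σ (Fin k → K.Carrier) λ c → x ≡ lincomb K k c basis
  basis-spans = proj₂ (proj₂ (proj₂ (proj₁ (proj₂ nmds))))

  d≤wt : ∀ x → 𝒞 x → x ≢ 0v K → d ≤ wt K x
  d≤wt = proj₂ (proj₁ (proj₂ (proj₂ nmds)))

  k≤wt : ∀ y → Dual K 𝒞 y → y ≢ 0v K → k ≤ wt K y
  k≤wt = proj₂ (proj₂ (proj₂ (proj₂ (proj₂ nmds))))

  -- The minimum distance is attained by a nonzero word, which has positive weight. Hence k < n, and
  -- the truncated difference n ∸ k is a true one.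
  1≤d : 1 ≤ d
  1≤d with proj₁ (proj₁ (proj₂ (proj₂ nmds)))
  ... | x , _ , x≢0 , wt≡d with LK.≢0v x x≢0
  ...   | p , xp≢0 = subst (1 ≤_) wt≡d (VK.wt-positive x p xp≢0)

  k≤n : k ≤ n
  k≤n = Nₚ.<⇒≤ (Nₚ.m∸n≢0⇒n<m (Nₚ.m<n⇒n≢0 1≤d))

  d+k≡n : d N.+ k ≡ n
  d+k≡n = Nₚ.m∸n+n≡m k≤n

  -- The generator matrix restricted to the columns `e`, as a family of rows; swapping the arguments
  -- gives the coordinate functionals.
  restrictedBasis : ∀ {t} → (Fin t → Fin n) → Fin k → Fin t → K.Carrier
  restrictedBasis e j i = lookup (basis j) (e i)

  -- The combination of the full basis with the same coefficients; independence of the basis keeps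
  -- it nonzero.
  dependent⇒codeword : ∀ {t} {e : Fin t → Fin n} → LK.Dependent (restrictedBasis e) →
    Σ (Vect K n) λ x → 𝒞 x × x ≢ 0v K × (∀ i → lookup x (e i) ≡ K.0#)
  dependent⇒codeword {e = e} (c , (j , cj≢0) , cb≡0) =
      lincomb K k c basis
    , lincomb-closed K linear k c basis basis-∈
    , (λ x≡0 → cj≢0 (basis-independent c x≡0 j))
    , (λ i → trans (LK.lookup-lincomb k c basis (e i)) (cb≡0 i))

  -- A dependency of the full rows would be a nonzero codeword that is zero everywhere. The family
  -- found is a one-sided inverse of the generator matrix, and its image under ι inverts `encode`.
  basis-biorthogonal : ∃ λ g → LK.Biorthogonal (restrictedBasis id) g
  basis-biorthogonal with LK.biorthogonal-or-dependent k (restrictedBasis id)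
  ... | inj₁ biorthogonal = biorthogonal
  ... | inj₂ dependent with dependent⇒codeword {e = id} dependent
  ...   | x , _ , x≢0 , x≡0 = contradiction (LK.≡0v x x≡0) x≢0

  -- A dependency among the coordinate functionals at fewer than k positions would be a dual codeword of weight < k.
  coordinates-biorthogonal : ∀ {t} (T : Positions n t) → t < k →
    ∃ λ g → LK.Biorthogonal (λ i j → restrictedBasis (embed T) j i) g
  coordinates-biorthogonal {t} T t<k with LK.biorthogonal-or-dependent t (λ i j → restrictedBasis (embed T) j i)
  ... | inj₁ biorthogonal = biorthogonal
  ... | inj₂ (c , (i , ci≢0) , cγ≡0) =
          contradiction (Nₚ.<-≤-trans t<k (k≤wt y y∈dual y≢0)) (Nₚ.≤⇒≯ (VK.wt-scatter T c))
    where
    y : Vect K n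
    y = VK.scatter T c
    y≢0 : y ≢ 0v K
    y≢0 y≡0 = ci≢0 (begin
      c i                      ≡⟨ sym (VK.lookup-scatter T c i) ⟩
      lookup y (embed T i)     ≡⟨ cong (λ z → lookup z (embed T i)) y≡0 ⟩
      lookup (0v K) (embed T i) ≡⟨ LK.lookup-0v (embed T i) ⟩
      K.0#                     ∎)
    y∈dual : Dual K 𝒞 y
    y∈dual x 𝒞x with basis-spans x 𝒞x
    ... | a , refl = begin
      dot K (lincomb K k a basis) y
        ≡⟨ VK.dot-scatter T (lincomb K k a basis) c ⟩
      LK.⟪ (λ i → lookup (lincomb K k a basis) (embed T i)) , c ⟫
        ≡⟨ LK.pair-comm _ c ⟩
      LK.⟪ c , (λ i → lookup (lincomb K k a basis) (embed T i)) ⟫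
        ≡⟨ LK.pair-cong {u = c} (λ _ → refl) (λ i → LK.lookup-lincomb k a basis (embed T i)) ⟩
      LK.⟪ c , (λ i → LK.⟪ a , (λ j → restrictedBasis (embed T) j i) ⟫) ⟫
        ≡⟨ LK.pair-assoc c a (restrictedBasis (embed T)) ⟩
      LK.⟪ a , (λ j → LK.⟪ c , restrictedBasis (embed T) j ⟫) ⟫
        ≡⟨ LK.pair-zeroʳ a _ cγ≡0 ⟩
      K.0# ∎

  -- Lagrange interpolation inside 𝒞: the family biorthogonal to the columns at `T` is read as
  -- coefficients over the basis. The words lie over the small field, so they serve every extension.
  interpolants : ∀ {t} (T : Positions n t) → t < k → Σ (Fin t → Vect K n) λ e →
    (∀ i → 𝒞 (e i)) × (∀ i j → lookup (e j) (embed T i) ≡ LK.δ i j)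
  interpolants T t<k with coordinates-biorthogonal T t<k
  ... | g , biorthogonal =
      (λ j → lincomb K k (g j) basis)
    , (λ j → lincomb-closed K linear k (g j) basis basis-∈)
    , (λ i j → trans (LK.lookup-lincomb k (g j) basis (embed T i)) 
        (trans (LK.pair-comm (g j) (λ l → restrictedBasis (embed T) l i)) (biorthogonal i j)))

  -- For t = k, the indicator that `T` is not an information set. It is decided over `K` alone, so
  -- all extensions share it.
  dependency : ∀ {t} → Positions n t → ℕ
  dependency T = [ (λ _ → 0) , (λ _ → 1) ]′ (LK.biorthogonal-or-dependent k (restrictedBasis (embed T)))

  dependencies : ℕ
  dependencies = sum (map dependency (positions n k))

  -- The lifted code: encoding, minimum distance, words vanishing on a set, moments

  module Lift {m : ℕ} (E : Extension K m) where
    open Extension E using (L; ι)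
    private
      module L = FiniteField L
      module LL = LinearAlgebra L
      module VL = Vectors L

    Q : ℕ
    Q = size L

    ι-vec : ∀ {r} → Vect K r → Vect L r
    ι-vec = Vec.map ι

    lookup-ι : ∀ {r} (x : Vect K r) p → lookup (ι-vec x) p ≡ ι (lookup x p)
    lookup-ι x p = Vecₚ.lookup-map p ι x

    -- `Lifted` admits combinations of any length of any codewords; messages over a fixed basis give
    -- each word once and make the code enumerable.
    encode : Vect L k → Vect L n
    encode a = lincomb L k (lookup a) (λ j → ι-vec (basis j))

    lookup-encode : ∀ a p → lookup (encode a) p ≡ LL.⟪ lookup a , (λ j → ι (lookup (basis j) p)) ⟫
    lookup-encode a p = trans (LL.lookup-lincomb k (lookup a) (λ j → ι-vec (basis j)) p)
      (LL.pair-cong {u = lookup a} (λ _ → refl) (λ j → lookup-ι (basis j) p))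

    encode-∈ : ∀ a → Lifted E 𝒞 (encode a)
    encode-∈ a = k , lookup a , basis , basis-∈ , refl

    ι-∈ : ∀ {x} → 𝒞 x → Lifted E 𝒞 (ι-vec x)
    ι-∈ {x} 𝒞x = 1 , (λ _ → L.1#) , (λ _ → x) , (λ _ → 𝒞x) , lookup-ext _ _ (λ p → sym (begin
      lookup (lincomb L 1 (λ _ → L.1#) (λ _ → ι-vec x)) p
        ≡⟨ LL.lookup-lincomb 1 (λ _ → L.1#) (λ _ → ι-vec x) p ⟩
      L.1# L.* lookup (ι-vec x) p L.+ L.0#
        ≡⟨ trans (LL.+-identityʳ _) (LL.*-identityˡ _) ⟩
      lookup (ι-vec x) p ∎))

    -- Each `v l` is expanded in the basis over `K`, and the order of summation is exchanged.
    encode-surjective : ∀ y → Lifted E 𝒞 y → ∃ λ a → y ≡ encode a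
    encode-surjective y (r , c , v , 𝒞v , refl) = a , lookup-ext _ _ eq
      where
      coeffs : Fin r → Fin k → K.Carrier
      coeffs l = proj₁ (basis-spans (v l) (𝒞v l))
      a : Vect L k
      a = tabulate (λ j → LL.⟪ c , (λ l → ι (coeffs l j)) ⟫)
      entry : ∀ p l → lookup (ι-vec (v l)) p ≡ LL.⟪ (λ j → ι (lookup (basis j) p)) , (λ j → ι (coeffs l j)) ⟫
      entry p l = begin
        lookup (ι-vec (v l)) p
          ≡⟨ lookup-ι (v l) p ⟩
        ι (lookup (v l) p)
          ≡⟨ cong (λ x → ι (lookup x p)) (proj₂ (basis-spans (v l) (𝒞v l))) ⟩
        ι (lookup (lincomb K k (coeffs l) basis) p)
          ≡⟨ cong ι (trans (LK.lookup-lincomb k (coeffs l) basis p) (LK.pair-comm (coeffs l) (λ j → lookup (basis j) p))) ⟩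
        ι LK.⟪ (λ j → lookup (basis j) p) , coeffs l ⟫
          ≡⟨ ι-pair E (λ j → lookup (basis j) p) (coeffs l) ⟩
        LL.⟪ (λ j → ι (lookup (basis j) p)) , (λ j → ι (coeffs l j)) ⟫ ∎
      eq : ∀ p → lookup (lincomb L r c (λ l → ι-vec (v l))) p ≡ lookup (encode a) p
      eq p = begin
        lookup (lincomb L r c (λ l → ι-vec (v l))) p
          ≡⟨ LL.lookup-lincomb r c (λ l → ι-vec (v l)) p ⟩
        LL.⟪ c , (λ l → lookup (ι-vec (v l)) p) ⟫
          ≡⟨ LL.pair-cong {u = c} (λ _ → refl) (entry p) ⟩
        LL.⟪ c , (λ l → LL.⟪ (λ j → ι (lookup (basis j) p)) , (λ j → ι (coeffs l j)) ⟫) ⟫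
          ≡⟨ sym (LL.pair-assoc (λ j → ι (lookup (basis j) p)) c (λ l j → ι (coeffs l j))) ⟩
        LL.⟪ (λ j → ι (lookup (basis j) p)) , (λ j → LL.⟪ c , (λ l → ι (coeffs l j)) ⟫) ⟫
          ≡⟨ LL.pair-cong {u = λ j → ι (lookup (basis j) p)} (λ _ → refl) (λ j → sym (Vecₚ.lookup∘tabulate _ j)) ⟩
        LL.⟪ (λ j → ι (lookup (basis j) p)) , lookup a ⟫
          ≡⟨ LL.pair-comm (λ j → ι (lookup (basis j) p)) (lookup a) ⟩
        LL.⟪ lookup a , (λ j → ι (lookup (basis j) p)) ⟫
          ≡⟨ sym (lookup-encode a p) ⟩
        lookup (encode a) p ∎

    -- The transported family is a one-sided inverse of the restricted generator matrix, so the
    -- entries at `e` determine the message.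
    decode : ∀ {t} {e : Fin t → Fin n} {g} → LK.Biorthogonal (restrictedBasis e) g → ∀ a j →
      LL.⟪ ι ∘ g j , (λ i → lookup (encode a) (e i)) ⟫ ≡ lookup a j
    decode {e = e} {g} biorthogonal a j = begin
      LL.⟪ ι ∘ g j , (λ i → lookup (encode a) (e i)) ⟫
        ≡⟨ LL.pair-cong {u = ι ∘ g j} (λ _ → refl) (λ i → lookup-encode a (e i)) ⟩
      LL.⟪ ι ∘ g j , (λ i → LL.⟪ lookup a , (λ j → ι (lookup (basis j) (e i))) ⟫) ⟫
        ≡⟨ LL.pair-assoc (ι ∘ g j) (lookup a) (λ j i → ι (lookup (basis j) (e i))) ⟩
      LL.⟪ lookup a , (λ l → LL.⟪ ι ∘ g j , ι ∘ restrictedBasis e l ⟫) ⟫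
        ≡⟨ LL.pair-cong {u = lookup a} (λ _ → refl) (λ l → trans (LL.pair-comm (ι ∘ g j) (ι ∘ restrictedBasis e l))
             (trans (ι-biorthogonal E {v = restrictedBasis e} {g} biorthogonal l j) (LL.δ-sym l j))) ⟩
      LL.⟪ lookup a , LL.δ j ⟫
        ≡⟨ LL.pair-δʳ (lookup a) j ⟩
      lookup a j ∎

    encode-injective : ∀ {a a′} → encode a ≡ encode a′ → a ≡ a′
    encode-injective {a} {a′} eq = lookup-ext a a′ λ j →
      trans (sym (decode {e = id} (proj₂ basis-biorthogonal) a j))
        (trans (cong (λ y → LL.⟪ ι ∘ proj₁ basis-biorthogonal j , lookup y ⟫) eq)
          (decode {e = id} (proj₂ basis-biorthogonal) a′ j))

    biorthogonal⇒vanishing-trivial : ∀ {t} {e : Fin t → Fin n} {g} → LK.Biorthogonal (restrictedBasis e) g →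
      ∀ y → Lifted E 𝒞 y → (∀ i → lookup y (e i) ≡ L.0#) → y ≡ 0v L
    biorthogonal⇒vanishing-trivial {e = e} {g} biorthogonal y 𝒞y y≡0 with encode-surjective y 𝒞y
    ... | a , refl = LL.≡0v (encode a) λ p → trans (lookup-encode a p) (LL.pair-zeroˡ (lookup a) _ λ j →
            trans (sym (decode {e = e} biorthogonal a j)) (LL.pair-zeroʳ (ι ∘ g j) _ y≡0))

    -- Combining the messages avoids concatenating two linear combinations.
    lifted-axpy : ∀ {x y} c → Lifted E 𝒞 x → Lifted E 𝒞 y → Lifted E 𝒞 (_⊕_ L x (_⊙_ L c y))
    lifted-axpy {x} {y} c 𝒞x 𝒞y with encode-surjective x 𝒞x | encode-surjective y 𝒞y
    ... | a , refl | b , refl = subst (Lifted E 𝒞) (lookup-ext _ _ eq) (encode-∈ a+cb)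
      where
      a+cb : Vect L k
      a+cb = tabulate (λ j → lookup a j L.+ c L.* lookup b j)
      eq : ∀ p → lookup (encode a+cb) p ≡ lookup (_⊕_ L (encode a) (_⊙_ L c (encode b))) p
      eq p = begin
        lookup (encode a+cb) p
          ≡⟨ lookup-encode a+cb p ⟩
        LL.⟪ lookup a+cb , B ⟫
          ≡⟨ LL.pair-cong {v = B} (Vecₚ.lookup∘tabulate (λ j → lookup a j L.+ c L.* lookup b j)) (λ _ → refl) ⟩
        LL.⟪ (λ j → lookup a j L.+ c L.* lookup b j) , B ⟫
          ≡⟨ LL.pair-linearˡ B (lookup a) (lookup b) c ⟩
        LL.⟪ lookup a , B ⟫ L.+ c L.* LL.⟪ lookup b , B ⟫
          ≡⟨ sym (cong₂ (λ u v → u L.+ c L.* v) (lookup-encode a p) (lookup-encode b p)) ⟩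
        lookup (encode a) p L.+ c L.* lookup (encode b) p
          ≡⟨ sym (LL.lookup-axpy (encode a) (encode b) c p) ⟩
        lookup (_⊕_ L (encode a) (_⊙_ L c (encode b))) p ∎
        where
        B : Fin k → L.Carrier
        B j = ι (lookup (basis j) p)

    -- Applied to the zero set of `y`: biorthogonality there would force y = 0, and a dependency
    -- gives a nonzero `x` in 𝒞 with all these zeros, hence d ≤ wt x ≤ wt y.
    lifted-d≤wt : ∀ y → Lifted E 𝒞 y → y ≢ 0v L → d ≤ wt L y
    lifted-d≤wt y 𝒞y y≢0 with LK.biorthogonal-or-dependent k (restrictedBasis (embed (VL.zeroPositions y)))
    ... | inj₁ (g , biorthogonal) = contradiction
            (biorthogonal⇒vanishing-trivial {e = embed (VL.zeroPositions y)} biorthogonal y 𝒞y (VL.vanishesOn-zeroPositions y)) y≢0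
    ... | inj₂ dependent with dependent⇒codeword {e = embed (VL.zeroPositions y)} dependent
    ...   | x , 𝒞x , x≢0 , Tx≡0 = Nₚ.≤-trans (d≤wt x 𝒞x x≢0) (Nₚ.+-cancelʳ-≤ (VL.zeros y) (wt K x) (wt L y)
              (Nₚ.≤-trans (VK.vanishing-wt (VL.zeroPositions y) x Tx≡0) (Nₚ.≤-reflexive (sym (VL.wt+zeros y)))))

    codewords : List (Vect L n)
    codewords = map encode (VL.vectors k)

    codewords-unique : Unique codewords
    codewords-unique = Uniqueₚ.map⁺ encode-injective (VL.vectors-unique k)

    length-codewords : length codewords ≡ Q ^ k
    length-codewords = trans (length-map encode (VL.vectors k)) (VL.length-vectors k)

    ∈-codewords⁺ : ∀ {y} → Lifted E 𝒞 y → y ∈ codewords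
    ∈-codewords⁺ {y} 𝒞y with encode-surjective y 𝒞y
    ... | a , refl = ∈-map⁺ encode (VL.∈-vectors a)

    ∈-codewords⁻ : ∀ {y} → y ∈ codewords → Lifted E 𝒞 y
    ∈-codewords⁻ y∈ with ∈-map⁻ encode y∈
    ... | a , _ , refl = encode-∈ a

    vanishing : ∀ {t} → Positions n t → List (Vect L n)
    vanishing T = filter (VL.vanishesOn? T) codewords

    vanishing-unique : ∀ {t} (T : Positions n t) → Unique (vanishing T)
    vanishing-unique T = Uniqueₚ.filter⁺ (VL.vanishesOn? T) codewords-unique

    ∈-vanishing⁺ : ∀ {t} (T : Positions n t) {y} → Lifted E 𝒞 y → VL.VanishesOn T y → y ∈ vanishing T
    ∈-vanishing⁺ T 𝒞y Ty≡0 = ∈-filter⁺ (VL.vanishesOn? T) (∈-codewords⁺ 𝒞y) Ty≡0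

    ∈-vanishing⁻ : ∀ {t} (T : Positions n t) {y} → y ∈ vanishing T → Lifted E 𝒞 y × VL.VanishesOn T y
    ∈-vanishing⁻ T y∈ with ∈-filter⁻ (VL.vanishesOn? T) {xs = codewords} y∈
    ... | y∈codewords , Ty≡0 = ∈-codewords⁻ y∈codewords , Ty≡0

    -- A splitting in place of rank-nullity: a codeword corresponds to its values on `T` together
    -- with what remains after subtracting their interpolation, a word vanishing on `T`. So the
    -- count times Q^t is Q^k.
    length-vanishing-< : ∀ {t} (T : Positions n t) → t < k → length (vanishing T) ≡ Q ^ (k ∸ t)
    length-vanishing-< {t} T t<k = Nₚ.*-cancelʳ-≡ _ _ (Q ^ t) {{Nₚ.m^n≢0 Q t {{VL.size-nonZero}}}} (begin
      length (vanishing T) N.* Q ^ t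
        ≡⟨ cong (length (vanishing T) N.*_) (sym (VL.length-vectors t)) ⟩
      length (vanishing T) N.* length (VL.vectors t)
        ≡⟨ sym (length-cartesianProductWith _,_ (vanishing T) (VL.vectors t)) ⟩
      length (cartesianProduct (vanishing T) (VL.vectors t))
        ≡⟨ length-cong (Uniqueₚ.cartesianProduct⁺ (vanishing-unique T) (VL.vectors-unique t))
             (Uniqueₚ.map⁺ split-injective codewords-unique) product⊆ ⊆product ⟩
      length (map split codewords)
        ≡⟨ trans (length-map split codewords) length-codewords ⟩
      Q ^ k
        ≡⟨ cong (Q ^_) (sym (Nₚ.m∸n+n≡m (Nₚ.<⇒≤ t<k))) ⟩
      Q ^ (k ∸ t N.+ t)
        ≡⟨ Nₚ.^-distribˡ-+-* Q (k ∸ t) t ⟩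
      Q ^ (k ∸ t) N.* Q ^ t ∎)
      where
      e : Fin t → Vect K n
      e = proj₁ (interpolants T t<k)
      e-∈ : ∀ i → 𝒞 (e i)
      e-∈ = proj₁ (proj₂ (interpolants T t<k))
      e-δ : ∀ i j → lookup (e j) (embed T i) ≡ LK.δ i j
      e-δ = proj₂ (proj₂ (interpolants T t<k))
      restrict : Vect L n → Vect L t
      restrict x = tabulate (λ i → lookup x (embed T i))
      interpolate : Vect L t → Vect L n
      interpolate v = lincomb L t (lookup v) (λ j → ι-vec (e j))
      interpolate-∈ : ∀ v → Lifted E 𝒞 (interpolate v)
      interpolate-∈ v = t , lookup v , e , e-∈ , refl
      lookup-interpolate : ∀ v i → lookup (interpolate v) (embed T i) ≡ lookup v i
      lookup-interpolate v i = begin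
        lookup (interpolate v) (embed T i)
          ≡⟨ LL.lookup-lincomb t (lookup v) (λ j → ι-vec (e j)) (embed T i) ⟩
        LL.⟪ lookup v , (λ j → lookup (ι-vec (e j)) (embed T i)) ⟫
          ≡⟨ LL.pair-cong {u = lookup v} (λ _ → refl) (λ j → trans (lookup-ι (e j) (embed T i)) (trans (cong ι (e-δ i j)) (ι-δ E i j))) ⟩
        LL.⟪ lookup v , LL.δ i ⟫
          ≡⟨ LL.pair-δʳ (lookup v) i ⟩
        lookup v i ∎
      split : Vect L n → Vect L n × Vect L t
      split x = _⊕_ L x (_⊙_ L (L.- L.1#) (interpolate (restrict x))) , restrict x
      -- The factor 1 gives `merge` the same form as `split`, so that `axpy-cancel` applies in both
      -- directions.
      merge : Vect L n × Vect L t → Vect L n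
      merge (y , v) = _⊕_ L y (_⊙_ L L.1# (interpolate v))
      merge-split : ∀ x → merge (split x) ≡ x
      merge-split x = LL.axpy-cancel x (interpolate (restrict x)) (LL.-‿inverseˡ L.1#)
      split-injective : ∀ {x x′} → split x ≡ split x′ → x ≡ x′
      split-injective {x} {x′} eq = trans (sym (merge-split x)) (trans (cong merge eq) (merge-split x′))
      split-∈ : ∀ {x} → Lifted E 𝒞 x → Lifted E 𝒞 (proj₁ (split x))
      split-∈ {x} 𝒞x = lifted-axpy _ 𝒞x (interpolate-∈ (restrict x))
      split-vanishes : ∀ x → VL.VanishesOn T (proj₁ (split x))
      split-vanishes x i = begin
        lookup (proj₁ (split x)) (embed T i)
          ≡⟨ LL.lookup-axpy x (interpolate (restrict x)) (L.- L.1#) (embed T i) ⟩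
        lookup x (embed T i) L.+ L.- L.1# L.* lookup (interpolate (restrict x)) (embed T i)
          ≡⟨ cong (λ a → lookup x (embed T i) L.+ L.- L.1# L.* a)
               (trans (lookup-interpolate (restrict x) i) (Vecₚ.lookup∘tabulate (λ i → lookup x (embed T i)) i)) ⟩
        lookup x (embed T i) L.+ L.- L.1# L.* lookup x (embed T i)
          ≡⟨ cong (lookup x (embed T i) L.+_) (trans (sym (LL.-‿distribˡ-* L.1# _)) (cong L.-_ (LL.*-identityˡ _))) ⟩
        lookup x (embed T i) L.+ L.- lookup x (embed T i)
          ≡⟨ LL.-‿inverseʳ (lookup x (embed T i)) ⟩
        L.0# ∎
      restrict-merge : ∀ y v → VL.VanishesOn T y → restrict (merge (y , v)) ≡ v
      restrict-merge y v Ty≡0 = lookup-ext _ v λ i → begin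
        lookup (restrict (merge (y , v))) i
          ≡⟨ Vecₚ.lookup∘tabulate (λ i → lookup (merge (y , v)) (embed T i)) i ⟩
        lookup (merge (y , v)) (embed T i)
          ≡⟨ LL.lookup-axpy y (interpolate v) L.1# (embed T i) ⟩
        lookup y (embed T i) L.+ L.1# L.* lookup (interpolate v) (embed T i)
          ≡⟨ cong₂ L._+_ (Ty≡0 i) (trans (LL.*-identityˡ _) (lookup-interpolate v i)) ⟩
        L.0# L.+ lookup v i
          ≡⟨ LL.+-identityˡ (lookup v i) ⟩
        lookup v i ∎
      split-merge : ∀ y v → VL.VanishesOn T y → split (merge (y , v)) ≡ (y , v)
      split-merge y v Ty≡0 = cong₂ _,_
        (trans (cong (λ w → _⊕_ L (merge (y , v)) (_⊙_ L (L.- L.1#) (interpolate w))) (restrict-merge y v Ty≡0))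
               (LL.axpy-cancel y (interpolate v) (LL.-‿inverseʳ L.1#)))
        (restrict-merge y v Ty≡0)
      product⊆ : ∀ {z} → z ∈ cartesianProduct (vanishing T) (VL.vectors t) → z ∈ map split codewords
      product⊆ {y , v} z∈ with ∈-vanishing⁻ T (proj₁ (∈-cartesianProduct⁻ (vanishing T) (VL.vectors t) z∈))
      ... | 𝒞y , Ty≡0 = subst (_∈ map split codewords) (split-merge y v Ty≡0)
              (∈-map⁺ split (∈-codewords⁺ (lifted-axpy L.1# 𝒞y (interpolate-∈ v))))
      ⊆product : ∀ {z} → z ∈ map split codewords → z ∈ cartesianProduct (vanishing T) (VL.vectors t)
      ⊆product z∈ with ∈-map⁻ split z∈
      ... | x , x∈ , refl = ∈-cartesianProduct⁺ (∈-vanishing⁺ T (split-∈ (∈-codewords⁻ x∈)) (split-vanishes x)) (VL.∈-vectors (restrict x))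

    -- Two non-proportional words vanishing on T would have a nonzero combination of weight < d.
    length-vanishing-dependent : (T : Positions n k) → LK.Dependent (restrictedBasis (embed T)) → length (vanishing T) ≡ Q
    length-vanishing-dependent T dependent with dependent⇒codeword {e = embed T} dependent
    ... | x , 𝒞x , x≢0 , Tx≡0 with LK.≢0v x x≢0
    ...   | p , xp≢0 with L.inverse (ι (lookup x p)) (ι-≢0 E xp≢0)
    ...     | b , xp*b≡1 = trans
              (length-cong (vanishing-unique T) (Uniqueₚ.map⁺ scale-injective L.unique) ⊆multiples multiples⊆)
              (length-map (λ a → _⊙_ L a x̂) L.elements)
      where
      x̂ : Vect L n
      x̂ = ι-vec x
      scale-injective : ∀ {a a′} → _⊙_ L a x̂ ≡ _⊙_ L a′ x̂ → a ≡ a′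
      scale-injective {a} {a′} eq = trans (sym (unscale a)) (trans (cong (λ y → lookup y p L.* b) eq) (unscale a′))
        where
        unscale : ∀ a → lookup (_⊙_ L a x̂) p L.* b ≡ a
        unscale a = begin
          lookup (_⊙_ L a x̂) p L.* b          ≡⟨ cong (L._* b) (LL.lookup-⊙ a x̂ p) ⟩
          a L.* lookup x̂ p L.* b              ≡⟨ cong (λ c → a L.* c L.* b) (lookup-ι x p) ⟩
          a L.* ι (lookup x p) L.* b          ≡⟨ LL.*-assoc _ _ _ ⟩
          a L.* (ι (lookup x p) L.* b)        ≡⟨ cong (a L.*_) xp*b≡1 ⟩
          a L.* L.1#                          ≡⟨ LL.*-identityʳ a ⟩
          a                                   ∎
      Tx̂≡0 : VL.VanishesOn T x̂
      Tx̂≡0 i = trans (lookup-ι x (embed T i)) (trans (cong ι (Tx≡0 i)) (ι-0 E))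
      multiples⊆ : ∀ {y} → y ∈ map (λ a → _⊙_ L a x̂) L.elements → y ∈ vanishing T
      multiples⊆ y∈ with ∈-map⁻ (λ a → _⊙_ L a x̂) y∈
      ... | a , _ , refl = ∈-vanishing⁺ T
              (1 , (λ _ → a) , (λ _ → x) , (λ _ → 𝒞x) , lookup-ext _ _ λ q →
                trans (LL.lookup-⊙ a x̂ q) (sym (trans (LL.lookup-lincomb 1 (λ _ → a) (λ _ → x̂) q) (LL.+-identityʳ _))))
              (λ i → trans (LL.lookup-⊙ a x̂ (embed T i)) (trans (cong (a L.*_) (Tx̂≡0 i)) (LL.zeroʳ a)))
      ⊆multiples : ∀ {y} → y ∈ vanishing T → y ∈ map (λ a → _⊙_ L a x̂) L.elements
      ⊆multiples {y} y∈ = subst (_∈ map (λ a → _⊙_ L a x̂) L.elements) (sym y≡ax̂)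
        (∈-map⁺ (λ a → _⊙_ L a x̂) (L.complete a))
        where
        𝒞y : Lifted E 𝒞 y
        𝒞y = proj₁ (∈-vanishing⁻ T y∈)
        Ty≡0 : VL.VanishesOn T y
        Ty≡0 = proj₂ (∈-vanishing⁻ T y∈)
        -- The ratio of y to x̂ at `p`. It makes `p` a zero of `z`, and `p` lies outside `T` because
        -- x vanishes on `T` but not at `p`.
        a : L.Carrier
        a = lookup y p L.* b
        z : Vect L n
        z = _⊕_ L y (_⊙_ L (L.- a) x̂)
        lookup-z : ∀ q → lookup z q ≡ lookup y q L.+ L.- a L.* lookup x̂ q
        lookup-z = LL.lookup-axpy y x̂ (L.- a)
        Tz≡0 : VL.VanishesOn T z
        Tz≡0 i = trans (lookup-z (embed T i))
          (trans (cong₂ (λ u v → u L.+ L.- a L.* v) (Ty≡0 i) (Tx̂≡0 i)) (trans (LL.+-identityˡ _) (LL.zeroʳ _)))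
        zp≡0 : lookup z p ≡ L.0#
        zp≡0 = trans (lookup-z p) (LL.sub-scale-self (lookup y p) (trans (cong (L._* b) (lookup-ι x p)) xp*b≡1))
        wt-z<d : wt L z < d
        wt-z<d = Nₚ.+-cancelʳ-< k (wt L z) d (subst (wt L z N.+ k <_) (sym d+k≡n)
          (VL.vanishing-wt-< T z p Tz≡0 zp≡0 (λ i i≡p → xp≢0 (trans (cong (lookup x) (sym i≡p)) (Tx≡0 i)))))
        z≡0 : z ≡ 0v L
        z≡0 = decidable-stable (Vecₚ.≡-dec L._≟_ z (0v L)) λ z≢0 →
          Nₚ.<⇒≱ wt-z<d (lifted-d≤wt z (lifted-axpy (L.- a) 𝒞y (ι-∈ 𝒞x)) z≢0)
        y≡ax̂ : y ≡ _⊙_ L a x̂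
        y≡ax̂ = lookup-ext y _ λ q → begin
          lookup y q
            ≡⟨ sym (LL.add-scales-cancel (lookup y q) (lookup x̂ q) (LL.-‿inverseˡ a)) ⟩
          (lookup y q L.+ L.- a L.* lookup x̂ q) L.+ a L.* lookup x̂ q
            ≡⟨ cong (L._+ a L.* lookup x̂ q) (trans (sym (lookup-z q)) (trans (cong (λ w → lookup w q) z≡0) (LL.lookup-0v q))) ⟩
          L.0# L.+ a L.* lookup x̂ q
            ≡⟨ LL.+-identityˡ _ ⟩
          a L.* lookup x̂ q
            ≡⟨ sym (LL.lookup-⊙ a x̂ q) ⟩
          lookup (_⊙_ L a x̂) q ∎

    nonzero? : (y : Vect L n) → Dec (y ≢ 0v L)
    nonzero? y = ¬? (Vecₚ.≡-dec L._≟_ y (0v L))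

    -- The zero word has n > k zeros and would break the bound that the inversion requires.
    nonzeroCodewords : List (Vect L n)
    nonzeroCodewords = filter nonzero? codewords

    nonzeroCodewords-unique : Unique nonzeroCodewords
    nonzeroCodewords-unique = Uniqueₚ.filter⁺ nonzero? codewords-unique

    ∈-nonzeroCodewords⁻ : ∀ {y} → y ∈ nonzeroCodewords → Lifted E 𝒞 y × y ≢ 0v L
    ∈-nonzeroCodewords⁻ y∈ with ∈-filter⁻ nonzero? {xs = codewords} y∈
    ... | y∈codewords , y≢0 = ∈-codewords⁻ y∈codewords , y≢0

    0v-∈ : Lifted E 𝒞 (0v L)
    0v-∈ = 0 , (λ ()) , (λ ()) , (λ ()) , refl

    nonzeroVanishing : ∀ {t} → Positions n t → List (Vect L n)
    nonzeroVanishing T = filter (VL.vanishesOn? T) nonzeroCodewords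

    -- The zero word is the only difference; it accounts for the 1 subtracted from each power of Q.
    length-vanishing : ∀ {t} (T : Positions n t) → length (vanishing T) ≡ suc (length (nonzeroVanishing T))
    length-vanishing T = length-cong (vanishing-unique T)
      (All.tabulate (λ y∈ 0≡y → proj₂ (∈-nonzeroCodewords⁻ (proj₁ (∈-filter⁻ (VL.vanishesOn? T) {xs = nonzeroCodewords} y∈))) (sym 0≡y))
        ∷ Uniqueₚ.filter⁺ (VL.vanishesOn? T) nonzeroCodewords-unique)
      to from
      where
      to : ∀ {y} → y ∈ vanishing T → y ∈ 0v L ∷ nonzeroVanishing T
      to {y} y∈ with Vecₚ.≡-dec L._≟_ y (0v L) | ∈-filter⁻ (VL.vanishesOn? T) {xs = codewords} y∈
      ... | yes refl | _ = here refl
      ... | no  y≢0  | y∈codewords , Ty≡0 = there (∈-filter⁺ (VL.vanishesOn? T) (∈-filter⁺ nonzero? y∈codewords y≢0) Ty≡0)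
      from : ∀ {y} → y ∈ 0v L ∷ nonzeroVanishing T → y ∈ vanishing T
      from (here refl) = ∈-vanishing⁺ T 0v-∈ (λ i → LL.lookup-0v (embed T i))
      from (there y∈) with ∈-filter⁻ (VL.vanishesOn? T) {xs = nonzeroCodewords} y∈
      ... | y∈′ , Ty≡0 = ∈-vanishing⁺ T (proj₁ (∈-nonzeroCodewords⁻ y∈′)) Ty≡0

    length-nonzeroVanishing : ∀ {t} (T : Positions n t) {c} → length (vanishing T) ≡ c → length (nonzeroVanishing T) ≡ c ∸ 1
    length-nonzeroVanishing T eq = trans (cong (_∸ 1) (sym (length-vanishing T))) (cong (_∸ 1) eq)

    -- The case distinction is literally the one in `dependency`: no nonzero word for an information
    -- set, and a line without its origin otherwise.
    length-nonzeroVanishing-k : (T : Positions n k) → length (nonzeroVanishing T) ≡ dependency T N.* (Q ∸ 1)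
    length-nonzeroVanishing-k T with LK.biorthogonal-or-dependent k (restrictedBasis (embed T))
    ... | inj₂ dependent = trans (length-nonzeroVanishing T (length-vanishing-dependent T dependent)) (sym (Nₚ.*-identityˡ (Q ∸ 1)))
    ... | inj₁ (g , biorthogonal) = cong length (filter-none (VL.vanishesOn? T) {xs = nonzeroCodewords} (All.tabulate λ {y} y∈ Ty≡0 →
            proj₂ (∈-nonzeroCodewords⁻ y∈)
              (biorthogonal⇒vanishing-trivial {e = embed T} biorthogonal y (proj₁ (∈-nonzeroCodewords⁻ y∈)) Ty≡0)))

    moment : ℕ → ℕ
    moment t = sum (map (λ y → VL.zeros y C t) nonzeroCodewords)

    moment≡ : ∀ t → moment t ≡ sum (map (λ T → length (nonzeroVanishing T)) (positions n t))
    moment≡ t = trans (sum-map-cong (λ y → sym (VL.count-vanishing y t)) nonzeroCodewords)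
      (double-count (λ y T → VL.vanishesOn? T y) nonzeroCodewords (positions n t))

    moment-< : ∀ {t} → t < k → moment t ≡ (n C t) N.* (Q ^ (k ∸ t) ∸ 1)
    moment-< {t} t<k = begin
      moment t
        ≡⟨ moment≡ t ⟩
      sum (map (λ T → length (nonzeroVanishing T)) (positions n t))
        ≡⟨ sum-map-cong (λ T → length-nonzeroVanishing T (length-vanishing-< T t<k)) (positions n t) ⟩
      sum (map (λ _ → Q ^ (k ∸ t) ∸ 1) (positions n t))
        ≡⟨ sum-map-const (Q ^ (k ∸ t) ∸ 1) (positions n t) ⟩
      length (positions n t) N.* (Q ^ (k ∸ t) ∸ 1)
        ≡⟨ cong (N._* (Q ^ (k ∸ t) ∸ 1)) (length-positions n t) ⟩
      (n C t) N.* (Q ^ (k ∸ t) ∸ 1) ∎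

    moment-k : moment k ≡ dependencies N.* (Q ∸ 1)
    moment-k = trans (moment≡ k) (trans (sum-map-cong length-nonzeroVanishing-k (positions n k))
      (sum-map-*ʳ dependency (Q ∸ 1) (positions n k)))

    zeros≤k : ∀ {y} → y ∈ nonzeroCodewords → VL.zeros y ≤ k
    zeros≤k {y} y∈ with ∈-nonzeroCodewords⁻ y∈
    ... | 𝒞y , y≢0 = Nₚ.+-cancelˡ-≤ (wt L y) (VL.zeros y) k
          (subst (_≤ wt L y N.+ k) (trans d+k≡n (sym (VL.wt+zeros y))) (Nₚ.+-monoˡ-≤ k (lifted-d≤wt y 𝒞y y≢0)))

    module _ {s : ℕ} (s≤k : s ≤ k) where
      private
        -- The number of zeros of a word of weight d+s, since n = d+k.
        a : ℕ
        a = k ∸ s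
        a+s≡k : a N.+ s ≡ k
        a+s≡k = Nₚ.m∸n+n≡m s≤k
        n≡a+[d+s] : n ≡ a N.+ (d N.+ s)
        n≡a+[d+s] = trans (sym d+k≡n) (trans (cong (d N.+_) (sym a+s≡k)) (shuffle d a s))
          where
          shuffle : ∀ x y z → x N.+ (y N.+ z) ≡ y N.+ (x N.+ z)
          shuffle x y z = trans (sym (Nₚ.+-assoc x y z)) (trans (cong (N._+ z) (Nₚ.+-comm x y)) (Nₚ.+-assoc y x z))

      weightCount≡ : ∀ {N} → WeightCount L (Lifted E 𝒞) (d N.+ s) N →
        N ≡ length (filter (λ y → VL.zeros y N.≟ a) nonzeroCodewords)
      weightCount≡ (ys , ys-unique , ys⊆ , ⊆ys , refl) = length-cong ys-unique
        (Uniqueₚ.filter⁺ (λ y → VL.zeros y N.≟ a) nonzeroCodewords-unique) to from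
        where
        total : ∀ y → wt L y N.+ VL.zeros y ≡ d N.+ s N.+ a
        total y = trans (VL.wt+zeros y) (trans n≡a+[d+s] (Nₚ.+-comm a (d N.+ s)))
        to : ∀ {y} → y ∈ ys → y ∈ filter (λ y → VL.zeros y N.≟ a) nonzeroCodewords
        to {y} y∈ with All.lookup ys⊆ y∈
        ... | 𝒞y , wt≡ = ∈-filter⁺ (λ y → VL.zeros y N.≟ a) (∈-filter⁺ nonzero? (∈-codewords⁺ 𝒞y) y≢0)
              (Nₚ.+-cancelˡ-≡ (d N.+ s) (VL.zeros y) a (trans (cong (N._+ VL.zeros y) (sym wt≡)) (total y)))
          where
          -- Leaving out the zero word loses nothing here, as d+s is positive.
          y≢0 : y ≢ 0v L
          y≢0 refl = Nₚ.m<n⇒n≢0 (Nₚ.≤-trans 1≤d (Nₚ.m≤m+n d s)) (trans (sym wt≡) (VL.wt-0v n))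
        from : ∀ {y} → y ∈ filter (λ y → VL.zeros y N.≟ a) nonzeroCodewords → y ∈ ys
        from {y} y∈ with ∈-filter⁻ (λ y → VL.zeros y N.≟ a) {xs = nonzeroCodewords} y∈
        ... | y∈′ , zeros≡a = ⊆ys y (proj₁ (∈-nonzeroCodewords⁻ y∈′) ,
              Nₚ.+-cancelʳ-≡ (VL.zeros y) (wt L y) (d N.+ s) (trans (total y) (cong (d N.+ s N.+_) (sym zeros≡a))))

      private
        moment-term : ∀ j → j < s →
          + ((a N.+ j) C a) Z.* + moment (a N.+ j) ≡ + (n C a) Z.* (+ ((d N.+ s) C j) Z.* (+ (Q ^ (s ∸ j)) - + 1))
        moment-term j j<s = begin
          + ((a N.+ j) C a) Z.* + moment (a N.+ j)
            ≡⟨ cong (λ u → + ((a N.+ j) C a) Z.* + u) (moment-< a+j<k) ⟩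
          + ((a N.+ j) C a) Z.* + ((n C (a N.+ j)) N.* (Q ^ (k ∸ (a N.+ j)) ∸ 1))
            ≡⟨ cong (λ e → + ((a N.+ j) C a) Z.* + ((n C (a N.+ j)) N.* (Q ^ e ∸ 1))) exponent ⟩
          + ((a N.+ j) C a) Z.* + ((n C (a N.+ j)) N.* (Q ^ (s ∸ j) ∸ 1))
            ≡⟨ cong (+ ((a N.+ j) C a) Z.*_) (trans (Zₚ.pos-* (n C (a N.+ j)) _) (cong (+ (n C (a N.+ j)) Z.*_) (pos-∸1 (Q ^ (s ∸ j)) {{Nₚ.m^n≢0 Q (s ∸ j) {{VL.size-nonZero}}}}))) ⟩
          + ((a N.+ j) C a) Z.* (+ (n C (a N.+ j)) Z.* q)
            ≡⟨ sym (Zₚ.*-assoc (+ ((a N.+ j) C a)) (+ (n C (a N.+ j))) q) ⟩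
          + ((a N.+ j) C a) Z.* + (n C (a N.+ j)) Z.* q
            ≡⟨ cong (Z._* q) (trans (sym (Zₚ.pos-* ((a N.+ j) C a) (n C (a N.+ j))))
                 (trans (cong +_ trinomial) (Zₚ.pos-* (n C a) ((d N.+ s) C j)))) ⟩
          + (n C a) Z.* + ((d N.+ s) C j) Z.* q
            ≡⟨ Zₚ.*-assoc (+ (n C a)) (+ ((d N.+ s) C j)) q ⟩
          + (n C a) Z.* (+ ((d N.+ s) C j) Z.* q) ∎
          where
          q : ℤ
          q = + (Q ^ (s ∸ j)) - + 1
          a+j<k : a N.+ j < k
          a+j<k = subst (a N.+ j <_) a+s≡k (Nₚ.+-monoʳ-< a j<s)
          exponent : k ∸ (a N.+ j) ≡ s ∸ j
          exponent = trans (cong (_∸ (a N.+ j)) (sym a+s≡k)) (Nₚ.[m+n]∸[m+o]≡n∸o a s j)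
          -- The source of C(n,k-s) and C(d+s,j) in the formula: the complement of `a` positions has
          -- size d+s.
          trinomial : ((a N.+ j) C a) N.* (n C (a N.+ j)) ≡ (n C a) N.* ((d N.+ s) C j)
          trinomial = subst (λ l → ((a N.+ j) C a) N.* (l C (a N.+ j)) ≡ (l C a) N.* ((d N.+ s) C j))
            (sym n≡a+[d+s]) (C-trinomial a (d N.+ s) j)

      -- The inverted moments are split at j = s: smaller indices are moments below k with known
      -- values, and j = s is the moment at k, carrying `dependencies`.
      weight-distribution : ∀ {N} → WeightCount L (Lifted E 𝒞) (d N.+ s) N →
        + N ≡ + (n C (k ∸ s)) Z.* sumTo s (λ j → sgn j Z.* + ((d N.+ s) C j) Z.* (+ (Q ^ (s ∸ j)) - + 1))
              Z.+ sgn s Z.* (+ (k C s) Z.* + (dependencies N.* (Q ∸ 1)))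
      weight-distribution {N} count = begin
        + N
          ≡⟨ cong +_ (weightCount≡ count) ⟩
        + length (filter (λ y → VL.zeros y N.≟ a) nonzeroCodewords)
          ≡⟨ count-by-moments VL.zeros a s nonzeroCodewords
               (All.tabulate λ {y} y∈ → subst (VL.zeros y ≤_) (sym a+s≡k) (zeros≤k y∈)) ⟩
        sumTo s (λ j → sgn j Z.* (+ ((a N.+ j) C a) Z.* + moment (a N.+ j)))
          Z.+ sgn s Z.* (+ ((a N.+ s) C a) Z.* + moment (a N.+ s))
          ≡⟨ cong₂ Z._+_ lower (cong (sgn s Z.*_) top) ⟩
        + (n C a) Z.* sumTo s (λ j → sgn j Z.* + ((d N.+ s) C j) Z.* (+ (Q ^ (s ∸ j)) - + 1))
          Z.+ sgn s Z.* (+ (k C s) Z.* + (dependencies N.* (Q ∸ 1))) ∎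
        where
        exchange : ∀ x y z w → x Z.* (y Z.* (z Z.* w)) ≡ y Z.* (x Z.* z Z.* w)
        exchange = ZS.solve-∀
        lower : sumTo s (λ j → sgn j Z.* (+ ((a N.+ j) C a) Z.* + moment (a N.+ j)))
          ≡ + (n C a) Z.* sumTo s (λ j → sgn j Z.* + ((d N.+ s) C j) Z.* (+ (Q ^ (s ∸ j)) - + 1))
        lower = trans
          (sumTo-cong s (λ j j<s → trans (cong (sgn j Z.*_) (moment-term j j<s))
            (exchange (sgn j) (+ (n C a)) (+ ((d N.+ s) C j)) (+ (Q ^ (s ∸ j)) - + 1))))
          (sym (sumTo-*ˡ s (+ (n C a)) _))
        top : + ((a N.+ s) C a) Z.* + moment (a N.+ s) ≡ + (k C s) Z.* + (dependencies N.* (Q ∸ 1))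
        top = cong₂ (λ u v → + u Z.* v) (trans (C-sym a s) (cong (_C s) a+s≡k)) (trans (cong (λ t → + moment t) a+s≡k) (cong +_ moment-k))

    -- The case s = 0, where only the exceptional moment remains.
    weightCount-d : ∀ {N} → WeightCount L (Lifted E 𝒞) d N → N ≡ dependencies N.* (Q ∸ 1)
    weightCount-d {N} count = Zₚ.+-injective (trans
      (weight-distribution {0} z≤n (subst (λ w → WeightCount L (Lifted E 𝒞) w N) (sym (Nₚ.+-identityʳ d)) count))
      (simplify (+ (n C k)) (+ (dependencies N.* (Q ∸ 1)))))
      where
      simplify : ∀ x y → x Z.* + 0 Z.+ + 1 Z.* (+ 1 Z.* y) ≡ y
      simplify = ZS.solve-∀

    weightCount-> : ∀ {s N} → k < s → WeightCount L (Lifted E 𝒞) (d N.+ s) N → N ≡ 0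
    weightCount-> k<s ([]     , _ , _ , _ , refl) = refl
    weightCount-> {s} k<s (y ∷ _ , _ , (_ , wt≡) ∷ _ , _ , refl) = contradiction
      (subst (n <_) (sym wt≡) (subst (_< d N.+ s) d+k≡n (Nₚ.+-monoʳ-< d k<s)))
      (Nₚ.≤⇒≯ (subst (wt L y ≤_) (VL.wt+zeros y) (Nₚ.m≤m+n (wt L y) (VL.zeros y))))

-- Identification of A_d(C) and the final formulas

trivialExtension : (K : FiniteField) → Extension K 1
trivialExtension K = record
  { L = K ; ι = id ; ι-+ = λ _ _ → refl ; ι-* = λ _ _ → refl ; ι-1 = refl ; size-L = sym (Nₚ.^-identityʳ (size K)) }

choose-≤ : ∀ n {k s} → s ≤ k → choose- n k s ≡ n C (k ∸ s)
choose-≤ n {k} {s} s≤k with s N.≤? k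
... | yes _   = refl
... | no  s≰k = contradiction s≤k s≰k

choose-> : ∀ n {k s} → k < s → choose- n k s ≡ 0
choose-> n {k} {s} k<s with s N.≤? k
... | yes s≤k = contradiction s≤k (Nₚ.<⇒≱ k<s)
... | no  _   = refl

module _ {K : FiniteField} {n k : ℕ} {𝒞 : Code K n} (nmds : IsNMDS K n k 𝒞) where
  open NMDS nmds

  trivialLift⁺ : ∀ {x} → 𝒞 x → Lifted (trivialExtension K) 𝒞 x
  trivialLift⁺ {x} 𝒞x = subst (Lifted (trivialExtension K) 𝒞) (Vecₚ.map-id x) (Lift.ι-∈ (trivialExtension K) 𝒞x)

  trivialLift⁻ : ∀ {x} → Lifted (trivialExtension K) 𝒞 x → 𝒞 x
  trivialLift⁻ (r , c , v , 𝒞v , refl) =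
    lincomb-closed K linear r c (Vec.map id ∘ v) (λ j → subst 𝒞 (sym (Vecₚ.map-id (v j))) (𝒞v j))

  -- The case m = 1 of `weightCount-d`: over the trivial extension the lifted code is 𝒞 itself.
  A_d≡ : ∀ {Ad} → WeightCount K 𝒞 d Ad → Ad ≡ dependencies N.* (size K ∸ 1)
  A_d≡ (xs , xs-unique , xs⊆ , ⊆xs , length≡) = Lift.weightCount-d (trivialExtension K)
    ( xs , xs-unique , All.map (λ { (𝒞x , wt≡) → trivialLift⁺ 𝒞x , wt≡ }) xs⊆
    , (λ { x (𝒞x , wt≡) → ⊆xs x (trivialLift⁻ 𝒞x , wt≡) }) , length≡)

  module _ {m : ℕ} (E : Extension K m) where
    open Extension E using (L; size-L)
    open Lift E
    private
      q : ℕ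
      q = size K
      instance
        q≢0 : NonZero q
        q≢0 = Vectors.size-nonZero K
        Q≢0 : NonZero Q
        Q≢0 = Vectors.size-nonZero L

    -- Multiplication by q-1 turns `dependencies` into A_d(C) and spares a division.
    lifted-weightCount : ∀ {Ad} → WeightCount K 𝒞 d Ad → ∀ s {N} → WeightCount L (Lifted E 𝒞) (d N.+ s) N →
      (+ size K - + 1) Z.* + N
        ≡ (+ size K - + 1) Z.* (+ choose- n k s Z.*
             sumTo s (λ j → sgn j Z.* + ((d N.+ s) C j) Z.* (+ (size K ^ (m N.* (s ∸ j))) - + 1)))
          Z.+ sgn s Z.* + (k C s) Z.* + Ad Z.* (+ (size K ^ m) - + 1)
    lifted-weightCount {Ad} countK s {N} count with Nₚ.≤-<-connex s k
    ... | inj₁ s≤k = begin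
      (+ q - + 1) Z.* + N
        ≡⟨ cong ((+ q - + 1) Z.*_) (weight-distribution s≤k count) ⟩
      (+ q - + 1) Z.* (+ (n C (k ∸ s)) Z.* S Q^ Z.+ sgn s Z.* (+ (k C s) Z.* + (dependencies N.* (Q ∸ 1))))
        ≡⟨ cong (λ u → (+ q - + 1) Z.* (+ (n C (k ∸ s)) Z.* S Q^ Z.+ sgn s Z.* (+ (k C s) Z.* u))) (pos-*-∸1 Q) ⟩
      (+ q - + 1) Z.* (+ (n C (k ∸ s)) Z.* S Q^ Z.+ sgn s Z.* (+ (k C s) Z.* (+ dependencies Z.* (+ Q - + 1))))
        ≡⟨ regroup (+ q - + 1) (+ (n C (k ∸ s))) (S Q^) (sgn s) (+ (k C s)) (+ dependencies) (+ Q - + 1) ⟩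
      (+ q - + 1) Z.* (+ (n C (k ∸ s)) Z.* S Q^)
        Z.+ sgn s Z.* + (k C s) Z.* (+ dependencies Z.* (+ q - + 1)) Z.* (+ Q - + 1)
        ≡⟨ cong₂ (λ u v → u Z.+ sgn s Z.* + (k C s) Z.* v Z.* (+ Q - + 1))
             (cong ((+ q - + 1) Z.*_) (cong₂ Z._*_ (cong +_ (sym (choose-≤ n s≤k))) S-Q))
             (trans (sym (pos-*-∸1 q)) (cong +_ (sym (A_d≡ countK)))) ⟩
      (+ q - + 1) Z.* (+ choose- n k s Z.* S q^m*) Z.+ sgn s Z.* + (k C s) Z.* + Ad Z.* (+ Q - + 1)
        ≡⟨ cong (λ u → (+ q - + 1) Z.* (+ choose- n k s Z.* S q^m*) Z.+ sgn s Z.* + (k C s) Z.* + Ad Z.* (+ u - + 1)) size-L ⟩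
      (+ q - + 1) Z.* (+ choose- n k s Z.* S q^m*) Z.+ sgn s Z.* + (k C s) Z.* + Ad Z.* (+ (q ^ m) - + 1) ∎
      where
      S : (ℕ → ℕ) → ℤ
      S powers = sumTo s (λ j → sgn j Z.* + ((d N.+ s) C j) Z.* (+ powers (s ∸ j) - + 1))
      Q^ : ℕ → ℕ
      Q^ e = Q ^ e
      q^m* : ℕ → ℕ
      q^m* e = q ^ (m N.* e)
      S-Q : S Q^ ≡ S q^m*
      S-Q = sumTo-cong s (λ j _ → cong (λ u → sgn j Z.* + ((d N.+ s) C j) Z.* (+ u - + 1))
        (trans (cong (_^ (s ∸ j)) size-L) (Nₚ.^-*-assoc q m (s ∸ j))))
      pos-*-∸1 : ∀ c → .{{NonZero c}} → + (dependencies N.* (c ∸ 1)) ≡ + dependencies Z.* (+ c - + 1)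
      pos-*-∸1 c = trans (Zₚ.pos-* dependencies (c ∸ 1)) (cong (+ dependencies Z.*_) (pos-∸1 c))
      regroup : ∀ x b S g κ β y → x Z.* (b Z.* S Z.+ g Z.* (κ Z.* (β Z.* y)))
        ≡ x Z.* (b Z.* S) Z.+ g Z.* κ Z.* (β Z.* x) Z.* y
      regroup = ZS.solve-∀
    -- Here d+s > n, so no word has this weight, and both C(n,k-s) and C(k,s) are zero.
    ... | inj₂ k<s rewrite weightCount-> k<s count | k>n⇒nCk≡0 k<s | choose-> n k<s =
      vanish (+ q - + 1) (sumTo s (λ j → sgn j Z.* + ((d N.+ s) C j) Z.* (+ (q ^ (m N.* (s ∸ j))) - + 1))) (sgn s) (+ Ad) (+ (q ^ m) - + 1)
      where
      vanish : ∀ x S g A y → x Z.* + 0 ≡ x Z.* (+ 0 Z.* S) Z.+ g Z.* + 0 Z.* A Z.* y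
      vanish = ZS.solve-∀

    module _ {Ad : ℕ} (countK : WeightCount K 𝒞 d Ad) (extremal : k N.* Ad ≡ choose- n k 1 N.* (size K ∸ 1)) where
      private
        -- The extremal hypothesis divided by q-1, which is positive because a field has two
        -- distinct elements.
        k*dependencies : k N.* dependencies ≡ choose- n k 1
        k*dependencies = Nₚ.*-cancelʳ-≡ _ _ (q ∸ 1) {{N.>-nonZero (Nₚ.m<n⇒0<n∸m (Vectors.1<size K))}}
          (trans (Nₚ.*-assoc k dependencies (q ∸ 1)) (trans (cong (k N.*_) (sym (A_d≡ countK))) extremal))

      extremal-weight-d : ∀ {N} → WeightCount L (Lifted E 𝒞) d N → k N.* N ≡ choose- n k 1 N.* (size K ^ m ∸ 1)
      extremal-weight-d {N} count = begin
        k N.* N                              ≡⟨ cong (k N.*_) (weightCount-d count) ⟩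
        k N.* (dependencies N.* (Q ∸ 1))     ≡⟨ sym (Nₚ.*-assoc k dependencies (Q ∸ 1)) ⟩
        k N.* dependencies N.* (Q ∸ 1)       ≡⟨ cong₂ (λ u v → u N.* (v ∸ 1)) k*dependencies size-L ⟩
        choose- n k 1 N.* (size K ^ m ∸ 1)   ∎

      -- At s = 1 the distribution reads C(n,k-1)(Q-1) minus k `dependencies` (Q-1), and
      -- `k*dependencies` makes the two equal. If k < 1, the weight exceeds n.
      extremal-weight-d+1 : ∀ {N} → WeightCount L (Lifted E 𝒞) (d N.+ 1) N → N ≡ 0
      extremal-weight-d+1 {N} count with Nₚ.≤-<-connex 1 k
      ... | inj₂ k<1 = weightCount-> k<1 count
      ... | inj₁ 1≤k = Zₚ.+-injective (begin
        + N
          ≡⟨ weight-distribution 1≤k count ⟩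
        + (n C (k ∸ 1)) Z.* (+ 0 Z.+ + 1 Z.* + 1 Z.* (+ (Q ^ 1) - + 1)) Z.+ Z.- + 1 Z.* (+ (k C 1) Z.* + (dependencies N.* (Q ∸ 1)))
          ≡⟨ cong₂ (λ u v → + (n C (k ∸ 1)) Z.* (+ 0 Z.+ + 1 Z.* + 1 Z.* u) Z.+ Z.- + 1 Z.* v) Q-1 top ⟩
        + (n C (k ∸ 1)) Z.* (+ 0 Z.+ + 1 Z.* + 1 Z.* + (Q ∸ 1)) Z.+ Z.- + 1 Z.* (+ (n C (k ∸ 1)) Z.* + (Q ∸ 1))
          ≡⟨ cancel (+ (n C (k ∸ 1))) (+ (Q ∸ 1)) ⟩
        + 0 ∎)
        where
        Q-1 : + (Q ^ 1) - + 1 ≡ + (Q ∸ 1)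
        Q-1 = trans (cong (λ u → + u - + 1) (Nₚ.^-identityʳ Q)) (sym (pos-∸1 Q))
        top : + (k C 1) Z.* + (dependencies N.* (Q ∸ 1)) ≡ + (n C (k ∸ 1)) Z.* + (Q ∸ 1)
        top = begin
          + (k C 1) Z.* + (dependencies N.* (Q ∸ 1))   ≡⟨ sym (Zₚ.pos-* (k C 1) _) ⟩
          + ((k C 1) N.* (dependencies N.* (Q ∸ 1)))   ≡⟨ cong (λ u → + (u N.* (dependencies N.* (Q ∸ 1)))) (nC1≡n k) ⟩
          + (k N.* (dependencies N.* (Q ∸ 1)))         ≡⟨ cong +_ (sym (Nₚ.*-assoc k dependencies (Q ∸ 1))) ⟩
          + (k N.* dependencies N.* (Q ∸ 1))           ≡⟨ cong (λ u → + (u N.* (Q ∸ 1))) (trans k*dependencies (choose-≤ n 1≤k)) ⟩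
          + ((n C (k ∸ 1)) N.* (Q ∸ 1))                ≡⟨ Zₚ.pos-* (n C (k ∸ 1)) (Q ∸ 1) ⟩
          + (n C (k ∸ 1)) Z.* + (Q ∸ 1)                ∎
        cancel : ∀ c y → c Z.* (+ 0 Z.+ + 1 Z.* + 1 Z.* y) Z.+ Z.- + 1 Z.* (c Z.* y) ≡ + 0
        cancel = ZS.solve-∀

-- The divisions by q-1 and by k appear as factors on the other side. Codes are arbitrary
-- predicates, so each weight number enters as any `N` that a complete duplicate-free list
-- certifies.
theorem3p5 : (K : FiniteField) (n k : ℕ) (𝒞 : Code K n) → IsNMDS K n k 𝒞 →
    (Ad : ℕ) → WeightCount K 𝒞 (n ∸ k) Ad →
    ( (m : ℕ) → 1 ≤ m → (E : Extension K m) → (s : ℕ) → 1 ≤ s →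
    (N : ℕ) → WeightCount (Extension.L E) (Lifted E 𝒞) ((n ∸ k) N.+ s) N →
    (+ size K - + 1) Z.* + N
    ≡ (+ size K - + 1) Z.* (+ choose- n k s Z.*
    sumTo s (λ j → sgn j Z.* + (((n ∸ k) N.+ s) C j)
    Z.* (+ (size K ^ (m N.* (s ∸ j))) - + 1)))
    Z.+ sgn s Z.* + (k C s) Z.* + Ad Z.* (+ (size K ^ m) - + 1) )
    × ( k N.* Ad ≡ choose- n k 1 N.* (size K ∸ 1) →
    (m : ℕ) → 1 ≤ m → (E : Extension K m) →
    ((N₀ : ℕ) → WeightCount (Extension.L E) (Lifted E 𝒞) (n ∸ k) N₀ →
    k N.* N₀ ≡ choose- n k 1 N.* (size K ^ m ∸ 1))
    × ((N₁ : ℕ) → WeightCount (Extension.L E) (Lifted E 𝒞) ((n ∸ k) N.+ 1) N₁ →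
    N₁ ≡ 0) )
theorem3p5 K n k 𝒞 nmds Ad countK =
    (λ m _ E s _ N count → lifted-weightCount nmds E countK s count)
  , (λ extremal m _ E → (λ N₀ count → extremal-weight-d nmds E countK extremal count)
                      , (λ N₁ count → extremal-weight-d+1 nmds E countK extremal count))
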